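{- For all integers $j\ge 2$ and $r\ge 2$, and every $r$-regular graph $G$ (connected or not), $\zeta_{2j}(G)\le 3+|B(G)|$.
   Context: Graphs are finite and loopless, but may have multiple edges. A bridge is an edge whose deletion results in a graph with exactly one more component than $G$; $B(G)$ is the (possibly empty) set of bridges of $G$. For a non-trivial abelian group $\mathbb{A}$ (written additively, identity $0$), a graph $G$ is zero-sum $\mathbb{A}$-magic if there is a function $\phi: E(G)\to \mathbb{A}\setminus\{0\}$ such that for every vertex $v$ the sum of $\phi(e)$ over all edges $e$ incident to $v$ is $0$. $\mathbb{Z}_n$ is the group of integers modulo $n$, and $\mathbb{Z}_n^k$ is the direct product of $k$ copies of it. For $j\ge 1$, $\zeta_{2j}(G)$ is the smallest positive integer $c$ such that $G$ is zero-sum $\mathbb{Z}_{2j}^c$-magic if such $c$ exists, and $\infty$ otherwise. -}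

module Defs where

open import Algebra.Bundles using (AbelianGroup)
import Algebra.Construct.Pointwise as Pointwise
open import Data.Fin.Base using (Fin; zero; suc; punchIn)
import Data.Fin.Properties as Fin
open import Data.Integer.Base as ℤ using (ℤ; +_; 0ℤ)
open import Data.Integer.Divisibility.Signed
  using (_∣_; divides; ∣m∣n⇒∣m+n; ∣m⇒∣-m)
import Data.Integer.Properties as ℤ
open import Data.Integer.Solver using (module +-*-Solver)
open import Data.List.Base using (List; length; filter; allFin; foldr; map; deduplicate)
open import Data.Nat.Base using (ℕ; zero; suc; _≤_)
import Data.Nat.Properties as ℕ
open import Data.Product.Base using (∃; _×_; _,_; proj₁; proj₂)
open import Data.Sum.Base using (_⊎_; inj₁; inj₂)
open import Data.Vec.Functional using (Vector; removeAt; tail)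
open import Level using (0ℓ; _⊔_)
open import Relation.Binary.Construct.Closure.Equivalence as EqC using (EqClosure)
open import Relation.Binary.Construct.Closure.ReflexiveTransitive using (ε; _◅_; _◅◅_)
open import Relation.Binary.Construct.Closure.Symmetric using (SymClosure; fwd; bwd)
open import Relation.Binary.Core using (Rel)
open import Relation.Binary.Definitions using (Decidable)
open import Relation.Binary.PropositionalEquality
  using (_≡_; _≢_; refl; subst)
open import Relation.Nullary.Construct.Add.Supremum using (_⁺; ⊤⁺; [_])
open import Relation.Binary.Construct.Add.Supremum.NonStrict _≤_ using (_≤⁺_) public
open import Relation.Nullary.Decidable using (map′; _×-dec_; _⊎-dec_)
open import Relation.Nullary.Negation using (¬_)
import Relation.Unary as Unary

-- A multigraph with n vertices and m edges.  Distinct edges may have the same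
-- ends; the order in which `ends` lists the two ends of an edge is immaterial.
record Graph (n m : ℕ) : Set where
  field
    ends     : Vector (Fin n × Fin n) m
    loopless : ∀ e → proj₁ (ends e) ≢ proj₂ (ends e)

open Graph public

Incident : ∀ {n m} → Graph n m → Fin n → Fin m → Set
Incident G v e = v ≡ proj₁ (ends G e) ⊎ v ≡ proj₂ (ends G e)

incident? : ∀ {n m} (G : Graph n m) (v : Fin n) → Unary.Decidable (Incident G v)
incident? G v e = (v Fin.≟ proj₁ (ends G e)) ⊎-dec (v Fin.≟ proj₂ (ends G e))

incidentEdges : ∀ {n m} → Graph n m → Fin n → List (Fin m)
incidentEdges {m = m} G v = filter (incident? G v) (allFin m)

degree : ∀ {n m} → Graph n m → Fin n → ℕ
degree G v = length (incidentEdges G v)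

Regular : ∀ {n m} → ℕ → Graph n m → Set
Regular r G = ∀ v → degree G v ≡ r

deleteEdge : ∀ {n m} → Graph n (suc m) → Fin (suc m) → Graph n m
deleteEdge G e = record
  { ends     = removeAt (ends G) e
  ; loopless = λ f → loopless G (punchIn e f)
  }

Joins : ∀ {n m} → Vector (Fin n × Fin n) m → Rel (Fin n) 0ℓ
Joins es u v = ∃ λ e → es e ≡ (u , v)

Connected : ∀ {n m} → Vector (Fin n × Fin n) m → Rel (Fin n) 0ℓ
Connected es = EqClosure (Joins es)

-- Decided by removing the first edge (a , b): u and v are connected iff they are
-- so without that edge, or by a walk that crosses it exactly once.
connected? : ∀ {n m} (es : Vector (Fin n × Fin n) m) → Decidable (Connected es)
connected? {m = zero} es u v = map′ (λ { refl → ε }) trivial (u Fin.≟ v)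
  where
  trivial : ∀ {x y} → Connected es x y → x ≡ y
  trivial ε                = refl
  trivial (fwd (() , _) ◅ _)
  trivial (bwd (() , _) ◅ _)
connected? {n} {suc m} es u v =
  map′ sound complete
    (con? u v ⊎-dec ((con? u a ×-dec con? b v) ⊎-dec (con? u b ×-dec con? a v)))
  where
  a b : Fin n
  a = proj₁ (es zero)
  b = proj₂ (es zero)

  Con : Rel (Fin n) 0ℓ
  Con = Connected (tail es)

  con? : Decidable Con
  con? = connected? (tail es)

  Crossing : Rel (Fin n) 0ℓ
  Crossing x y = Con x y ⊎ (Con x a × Con b y) ⊎ (Con x b × Con a y)

  weaken : ∀ {x y} → Con x y → Connected es x y
  weaken = EqC.map (λ { (e , eq) → suc e , eq })

  sound : ∀ {x y} → Crossing x y → Connected es x y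
  sound (inj₁ p)              = weaken p
  sound (inj₂ (inj₁ (p , q))) = weaken p ◅◅ (fwd (zero , refl) ◅ weaken q)
  sound (inj₂ (inj₂ (p , q))) = weaken p ◅◅ (bwd (zero , refl) ◅ weaken q)

  prepend : ∀ {x w y} → SymClosure (Joins (tail es)) x w → Crossing w y → Crossing x y
  prepend s (inj₁ p)              = inj₁ (s ◅ p)
  prepend s (inj₂ (inj₁ (p , q))) = inj₂ (inj₁ (s ◅ p , q))
  prepend s (inj₂ (inj₂ (p , q))) = inj₂ (inj₂ (s ◅ p , q))

  crossFwd : ∀ {y} → Crossing b y → Crossing a y
  crossFwd (inj₁ p)              = inj₂ (inj₁ (ε , p))
  crossFwd (inj₂ (inj₁ (_ , q))) = inj₂ (inj₁ (ε , q))
  crossFwd (inj₂ (inj₂ (_ , q))) = inj₁ q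

  crossBwd : ∀ {y} → Crossing a y → Crossing b y
  crossBwd (inj₁ p)              = inj₂ (inj₂ (ε , p))
  crossBwd (inj₂ (inj₁ (_ , q))) = inj₁ q
  crossBwd (inj₂ (inj₂ (_ , q))) = inj₂ (inj₂ (ε , q))

  complete : ∀ {x y} → Connected es x y → Crossing x y
  complete ε                          = inj₁ ε
  complete (fwd (zero  , refl) ◅ w) = crossFwd (complete w)
  complete (bwd (zero  , refl) ◅ w) = crossBwd (complete w)
  complete (fwd (suc e , eq)   ◅ w) = prepend (fwd (e , eq)) (complete w)
  complete (bwd (suc e , eq)   ◅ w) = prepend (bwd (e , eq)) (complete w)

-- `deduplicate` keeps exactly one vertex from each component.
numComponents : ∀ {n m} → Graph n m → ℕ
numComponents {n} G = length (deduplicate (connected? (ends G)) (allFin n))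

IsBridge : ∀ {n m} → Graph n m → Fin m → Set
IsBridge {m = suc _} G e = numComponents (deleteEdge G e) ≡ suc (numComponents G)

isBridge? : ∀ {n m} (G : Graph n m) → Unary.Decidable (IsBridge G)
isBridge? {m = suc _} G e = numComponents (deleteEdge G e) ℕ.≟ suc (numComponents G)

bridges : ∀ {n m} → Graph n m → List (Fin m)
bridges {m = m} G = filter (isBridge? G) (allFin m)

ZeroSumMagic : ∀ {n m c ℓ} → AbelianGroup c ℓ → Graph n m → Set (c ⊔ ℓ)
ZeroSumMagic {m = m} 𝔸 G =
  ∃ λ (φ : Fin m → A.Carrier) →
    (∀ e → ¬ φ e A.≈ A.ε) ×
    (∀ v → foldr A._∙_ A.ε (map φ (incidentEdges G v)) A.≈ A.ε)
  where module A = AbelianGroup 𝔸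

-- The integers modulo n: the carrier is ℤ, and equality is congruence modulo n.
ℤMod : ℕ → AbelianGroup 0ℓ 0ℓ
ℤMod n = record
  { Carrier = ℤ
  ; _≈_     = _≈_
  ; _∙_     = ℤ._+_
  ; ε       = 0ℤ
  ; _⁻¹     = ℤ.-_
  ; isAbelianGroup = record
    { isGroup = record
      { isMonoid = record
        { isSemigroup = record
          { isMagma = record
            { isEquivalence = record
              { refl  = λ {x} → ≡⇒≈ {x} refl
              ; sym   = λ {x} {y} p → subst (+ n ∣_) (sym-eq x y) (∣m⇒∣-m p)
              ; trans = λ {x} {y} {z} p q →
                  subst (+ n ∣_) (trans-eq x y z) (∣m∣n⇒∣m+n p q)
              }
            ; ∙-cong = λ {x} {y} {u} {v} p q →
                subst (+ n ∣_) (+-eq x y u v) (∣m∣n⇒∣m+n p q)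
            }
          ; assoc = λ x y z → ≡⇒≈ (ℤ.+-assoc x y z)
          }
        ; identity = (λ x → ≡⇒≈ (ℤ.+-identityˡ x)) , (λ x → ≡⇒≈ (ℤ.+-identityʳ x))
        }
      ; inverse = (λ x → ≡⇒≈ (ℤ.+-inverseˡ x)) , (λ x → ≡⇒≈ (ℤ.+-inverseʳ x))
      ; ⁻¹-cong = λ {x} {y} p → subst (+ n ∣_) (neg-eq x y) (∣m⇒∣-m p)
      }
    ; comm = λ x y → ≡⇒≈ (ℤ.+-comm x y)
    }
  }
  where
  open +-*-Solver

  _≈_ : Rel ℤ 0ℓ
  x ≈ y = + n ∣ x ℤ.- y

  ≡⇒≈ : ∀ {x y} → x ≡ y → x ≈ y
  ≡⇒≈ {x} refl = divides 0ℤ (ℤ.+-inverseʳ x)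

  sym-eq : ∀ x y → ℤ.- (x ℤ.- y) ≡ y ℤ.- x
  sym-eq = solve 2 (λ x y → :- (x :- y) := y :- x) refl

  neg-eq : ∀ x y → ℤ.- (x ℤ.- y) ≡ ℤ.- x ℤ.- ℤ.- y
  neg-eq = solve 2 (λ x y → :- (x :- y) := :- x :- :- y) refl

  trans-eq : ∀ x y z → (x ℤ.- y) ℤ.+ (y ℤ.- z) ≡ x ℤ.- z
  trans-eq = solve 3 (λ x y z → (x :- y) :+ (y :- z) := x :- z) refl

  +-eq : ∀ x y u v → (x ℤ.- y) ℤ.+ (u ℤ.- v) ≡ (x ℤ.+ u) ℤ.- (y ℤ.+ v)
  +-eq = solve 4 (λ x y u v → (x :- y) :+ (u :- v) := (x :+ u) :- (y :+ v)) refl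

-- The direct product of k copies of ℤMod n, as functions Fin k → ℤMod n.
ℤMod^ : ℕ → ℕ → AbelianGroup 0ℓ 0ℓ
ℤMod^ n k = Pointwise.abelianGroup (Fin k) (ℤMod n)

-- `IsZeta k G z` says ζ_k(G) = z, where z ranges over ℕ extended by ∞ = ⊤⁺.
-- It determines z uniquely.
IsZeta : ∀ {n m} → ℕ → Graph n m → ℕ ⁺ → Set
IsZeta k G [ c ] =
  1 ≤ c × ZeroSumMagic (ℤMod^ k c) G ×
  (∀ d → 1 ≤ d → ZeroSumMagic (ℤMod^ k d) G → c ≤ d)
IsZeta k G ⊤⁺ = ∀ d → 1 ≤ d → ¬ ZeroSumMagic (ℤMod^ k d) G

{-# OPTIONS --safe #-}
-- Non-bridges are covered by odd values of three integer labellings with even sums at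
-- all vertices; multiplied by j, these are zero-sum modulo 2j.  They come from
-- Seymour's growth argument: after contracting an edge of each edge cut of size at most
-- 2, one repeatedly contracts, into a root s, a connected even subgraph joined to s by
-- two edges a and b.  Such subgraphs exist by Menger's theorem; together they make up
-- the third labelling C, while the first two (f and g, integer flows) cover all other
-- edges, including a and b.
-- A bridge of an r-regular graph gets a coordinate of its own: since r ≥ 2, neither
-- side of the bridge is bipartite, so labels alternating along an odd closed walk on
-- each side balance the label 2 on the bridge, and 2 is nonzero modulo 2j because j ≥
-- 2.
module Submission where

open import Defs
open import Algebra.Bundles using (AbelianGroup)
import Algebra.Properties.Semiring.Sum as SemiringSum
open import Data.Bool.Base using (Bool; true; false; not; _∧_; _∨_; _xor_; if_then_else_)
import Data.Bool.Properties as Bool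
open import Data.Empty using (⊥; ⊥-elim)
open import Data.Fin.Base using (Fin; zero; suc; toℕ; fromℕ<; punchIn; punchOut; splitAt; _↑ˡ_; _↑ʳ_)
import Data.Fin.Properties as Fin
open import Data.Integer.Base as ℤ using (ℤ; 0ℤ; 1ℤ; -1ℤ; _+_; _*_; _-_; -_)
open import Data.Integer.Divisibility.Signed
  using (_∣_; divides; _∣?_; ∣m∣n⇒∣m+n; ∣m+n∣m⇒∣n; ∣m⇒∣-m; ∣m⇒∣m*n; ∣n⇒∣m*n; *-monoʳ-∣; *-cancelˡ-∣; ∣⇒∣ᵤ)
import Data.Integer.DivMod as ℤ
import Data.Integer.Properties as ℤ
open import Data.Integer.Tactic.RingSolver using (solve-∀)
open import Data.List.Base using (List; []; _∷_; length; filter; allFin; deduplicate; foldr; map; tabulate; lookup)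
open import Data.List.Membership.Propositional using (_∈_; lose)
open import Data.List.Membership.Propositional.Properties using (∈-allFin; ∈-lookup; ∈-filter⁺)
open import Data.List.Relation.Unary.All as All using (All; []; _∷_)
import Data.List.Relation.Unary.All.Properties as All
open import Data.List.Relation.Unary.AllPairs using (AllPairs; []; _∷_)
import Data.List.Relation.Unary.AllPairs.Properties as AllPairs
open import Data.List.Relation.Unary.Any as Any using (Any; here; there; index)
import Data.List.Relation.Unary.Any.Properties as Any
import Data.List.Relation.Unary.Unique.DecSetoid.Properties as Unique
open import Data.Nat.Base as ℕ using (ℕ; zero; suc; z≤n; s≤s; _≤_; _<_)
import Data.Nat.Divisibility as ℕ
import Data.Nat.Properties as ℕ
open import Data.Product.Base using (∃; _×_; _,_; proj₁; proj₂)
import Data.Product.Properties as ×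
open import Data.Sum.Base using (_⊎_; inj₁; inj₂)
open import Data.Vec.Functional as Vector using (Vector; updateAt; removeAt)
open import Data.Vec.Functional.Properties using (updateAt-updates; updateAt-minimal)
open import Function.Base using (const; _∘_; case_of_; id)
open import Level using (0ℓ)
open import Relation.Binary.Construct.Add.Supremum.NonStrict _≤_ using ([_])
import Relation.Binary.Construct.Closure.Equivalence as EqC
import Relation.Binary.Construct.On as On
open import Relation.Binary.Core using (Rel)
open import Relation.Binary.Definitions using (Decidable)
open import Relation.Binary.PropositionalEquality hiding (J; [_])
open import Relation.Binary.Structures using (IsEquivalence)
open import Relation.Nullary.Construct.Add.Supremum using (_⁺; [_])
open import Relation.Nullary.Decidable
  using (Dec; yes; no; does; dec-true; dec-false; _×-dec_; _⊎-dec_; _→-dec_; ¬?; map′; from-yes; decidable-stable)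
open import Relation.Nullary.Negation using (¬_; contradiction)
import Relation.Unary as Unary

open SemiringSum ℤ.+-*-semiring
  using (sum; sum-cong-≗; sum-replicate-zero; ∑-distrib-+; ∑-comm; *-distribˡ-sum; *-distribʳ-sum)
private module ℕΣ = SemiringSum ℕ.+-*-semiring

-- An odd multiple of `j` is nonzero modulo `2j` and an even one is zero, so away from the bridges
-- only parities matter; the labellings are nevertheless integral, because flow augmentation works
-- with signs. A labelling with even boundary has even sum over every edge cut. Hence an edge that
-- is a cut by itself is never odd, which is why bridges need coordinates of their own, while the
-- two edges of a 2-cut agree in parity, so one of them can be contracted and recovered. Two flows
-- are needed because of `a`: undoing a contraction sends the whole excess of the contracted set
-- through `a`, so the parity there is uncontrolled. If it is even in both flows, a circuit through
-- `a` and `b` is added to one of them; this may spoil `b` there, but `b` stays odd in the other.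
-- Contraction only redirects ends, so the vertex and edge types never change. The price is loops:
-- they are invisible to the signed boundary, so their values can be reset at will, and coverage is
-- demanded of non-loops only.

private variable
  n m : ℕ

-- Boundaries of edge labellings

Ends : ℕ → ℕ → Set
Ends n m = Vector (Fin n × Fin n) m

tl hd : Ends n m → Fin m → Fin n
tl es e = proj₁ (es e)
hd es e = proj₂ (es e)

infixl 6 _[_]≔_
_[_]≔_ : {A : Set} → Vector A n → Fin n → A → Vector A n
xs [ i ]≔ v = updateAt xs i (const v)

≔-eq : {A : Set} (xs : Vector A n) (i : Fin n) {v : A} → (xs [ i ]≔ v) i ≡ v
≔-eq xs i = updateAt-updates i xs

≔-≢ : {A : Set} (xs : Vector A n) {i j : Fin n} {v : A} → j ≢ i → (xs [ i ]≔ v) j ≡ xs j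
≔-≢ xs {i} {j} j≢i = updateAt-minimal j i xs j≢i

true≢false : {b : Bool} → b ≡ true → b ≡ false → ⊥
true≢false refl ()

χ : Bool → ℤ
χ b = if b then 1ℤ else 0ℤ

abstract
  δ : Fin n → Fin n → ℤ
  δ x y = χ (does (x Fin.≟ y))

  δ-refl : (x : Fin n) → δ x x ≡ 1ℤ
  δ-refl x = cong χ (dec-true (x Fin.≟ x) refl)

  δ-≢ : {x y : Fin n} → x ≢ y → δ x y ≡ 0ℤ
  δ-≢ {x = x} {y} x≢y = cong χ (dec-false (x Fin.≟ y) x≢y)

sum-0 : (f : Fin n → ℤ) → (∀ x → f x ≡ 0ℤ) → sum f ≡ 0ℤ
sum-0 {n} f f≡0 = trans (sum-cong-≗ f≡0) (sum-replicate-zero n)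

-- Unlike sum-remove, this keeps the index type.
sum-split : (f : Fin n → ℤ) (x : Fin n) → sum f ≡ f x + sum (f [ x ]≔ 0ℤ)
sum-split f zero = cong (f zero +_) (sym (ℤ.+-identityˡ _))
sum-split f (suc x) = trans (cong (f zero +_) (sum-split (f ∘ suc) x)) (swap (f zero) (f (suc x)) _)
  where
  swap : ∀ a b c → a + (b + c) ≡ b + (a + c)
  swap = solve-∀

sum-single : (f : Fin n → ℤ) (x : Fin n) → (∀ y → y ≢ x → f y ≡ 0ℤ) → sum f ≡ f x
sum-single f x f≡0 = trans (sum-split f x) (trans (cong (f x +_) (sum-0 _ rest)) (ℤ.+-identityʳ _))
  where
  rest : ∀ y → (f [ x ]≔ 0ℤ) y ≡ 0ℤ
  rest y with y Fin.≟ x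
  ... | yes refl = ≔-eq f x
  ... | no y≢x   = trans (≔-≢ f y≢x) (f≡0 y y≢x)

sum-δ : (F : Fin n → ℤ) (x : Fin n) → sum (λ y → F y * δ y x) ≡ F x
sum-δ F x = trans (sum-single _ x λ y y≢x → trans (cong (F y *_) (δ-≢ y≢x)) (ℤ.*-zeroʳ (F y)))
                  (trans (cong (F x *_) (δ-refl x)) (ℤ.*-identityʳ (F x)))

-- The boundary of an edge labelling: signed for κ = -1, unsigned for κ = 1.
∂ : ℤ → Ends n m → (Fin m → ℤ) → Fin n → ℤ
∂ κ es f x = sum λ e → f e * (δ x (hd es e) + κ * δ x (tl es e))

-- Summation by parts. With `F` an indicator it turns a condition on boundaries into a sum over the
-- edges of a cut; the augmenting, component, parity and colouring arguments below all use it.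
pairing : ∀ κ (es : Ends n m) (F : Fin n → ℤ) (f : Fin m → ℤ) →
  sum (λ x → F x * ∂ κ es f x) ≡ sum (λ e → f e * (F (hd es e) + κ * F (tl es e)))
pairing {n} {m} κ es F f = begin
  sum (λ x → F x * ∂ κ es f x)
    ≡⟨ sum-cong-≗ (λ x → *-distribˡ-sum {m} (F x) _) ⟩
  sum (λ x → sum λ e → F x * (f e * (δ x (hd es e) + κ * δ x (tl es e))))
    ≡⟨ ∑-comm {n} {m} _ ⟩
  sum (λ e → sum λ x → F x * (f e * (δ x (hd es e) + κ * δ x (tl es e))))
    ≡⟨ sum-cong-≗ edge ⟩
  sum (λ e → f e * (F (hd es e) + κ * F (tl es e))) ∎
  where
  open ≡-Reasoning
  ring₁ : ∀ a b c d k → a * (b * (c + k * d)) ≡ b * (a * c) + (b * k) * (a * d)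
  ring₁ = solve-∀
  ring₂ : ∀ b c d k → b * c + (b * k) * d ≡ b * (c + k * d)
  ring₂ = solve-∀
  edge : ∀ e → sum (λ x → F x * (f e * (δ x (hd es e) + κ * δ x (tl es e)))) ≡ f e * (F (hd es e) + κ * F (tl es e))
  edge e = begin
    sum (λ x → F x * (f e * (δ x h + κ * δ x t)))
      ≡⟨ sum-cong-≗ (λ x → ring₁ (F x) (f e) (δ x h) (δ x t) κ) ⟩
    sum (λ x → f e * (F x * δ x h) + (f e * κ) * (F x * δ x t))
      ≡⟨ ∑-distrib-+ (λ x → f e * (F x * δ x h)) _ ⟩
    sum (λ x → f e * (F x * δ x h)) + sum (λ x → (f e * κ) * (F x * δ x t))
      ≡⟨ cong₂ _+_ (sym (*-distribˡ-sum (f e) (λ x → F x * δ x h))) (sym (*-distribˡ-sum (f e * κ) (λ x → F x * δ x t))) ⟩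
    f e * sum (λ x → F x * δ x h) + (f e * κ) * sum (λ x → F x * δ x t)
      ≡⟨ cong₂ (λ a b → f e * a + (f e * κ) * b) (sum-δ F h) (sum-δ F t) ⟩
    f e * F h + (f e * κ) * F t
      ≡⟨ ring₂ (f e) (F h) (F t) κ ⟩
    f e * (F h + κ * F t) ∎
    where
    h = hd es e
    t = tl es e

∂-+ : ∀ κ (es : Ends n m) (f g : Fin m → ℤ) x → ∂ κ es (λ e → f e + g e) x ≡ ∂ κ es f x + ∂ κ es g x
∂-+ κ es f g x = trans (sum-cong-≗ λ e → ℤ.*-distribʳ-+ _ (f e) (g e))
                       (∑-distrib-+ (λ e → f e * _) _)

∂-* : ∀ κ (es : Ends n m) c (f : Fin m → ℤ) x → ∂ κ es (λ e → c * f e) x ≡ c * ∂ κ es f x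
∂-* κ es c f x = trans (sum-cong-≗ λ e → ℤ.*-assoc c (f e) _) (sym (*-distribˡ-sum c (λ e → f e * _)))

∂-sum : ∀ κ (es : Ends n m) {k} (J : Fin k → Fin m → ℤ) x →
  ∂ κ es (λ e → sum λ y → J y e) x ≡ sum λ y → ∂ κ es (J y) x
∂-sum {m = m} κ es {k} J x = trans (sum-cong-≗ λ e → *-distribʳ-sum (δ x (hd es e) + κ * δ x (tl es e)) (λ y → J y e)) (∑-comm {m} {k} _)

∂-0 : ∀ κ (es : Ends n m) x → ∂ κ es (const 0ℤ) x ≡ 0ℤ
∂-0 κ es x = sum-0 _ λ e → ℤ.*-zeroˡ (δ x (hd es e) + κ * δ x (tl es e))

∂-δ : ∀ κ (es : Ends n m) e x → ∂ κ es (λ e′ → δ e′ e) x ≡ δ x (hd es e) + κ * δ x (tl es e)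
∂-δ κ es e x = trans (sum-cong-≗ λ e′ → ℤ.*-comm (δ e′ e) _) (sum-δ (λ e′ → δ x (hd es e′) + κ * δ x (tl es e′)) e)

-- Boolean sets: counting and closure

bit : Bool → ℕ
bit b = if b then 1 else 0

count : (Fin n → Bool) → ℕ
count c = ℕΣ.sum (bit ∘ c)

sum-mono-≤ : (f g : Fin n → ℕ) → (∀ x → f x ≤ g x) → ℕΣ.sum f ≤ ℕΣ.sum g
sum-mono-≤ {zero}  f g f≤g = z≤n
sum-mono-≤ {suc n} f g f≤g = ℕ.+-mono-≤ (f≤g zero) (sum-mono-≤ (f ∘ suc) (g ∘ suc) (f≤g ∘ suc))

sum-mono-< : (f g : Fin n → ℕ) → (∀ x → f x ≤ g x) → ∀ x → f x < g x → ℕΣ.sum f < ℕΣ.sum g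
sum-mono-< f g f≤g zero    fx<gx = ℕ.+-mono-<-≤ fx<gx (sum-mono-≤ (f ∘ suc) (g ∘ suc) (f≤g ∘ suc))
sum-mono-< f g f≤g (suc x) fx<gx = ℕ.+-mono-≤-< (f≤g zero) (sum-mono-< (f ∘ suc) (g ∘ suc) (f≤g ∘ suc) x fx<gx)

bit-mono : {a b : Bool} → (a ≡ true → b ≡ true) → bit a ≤ bit b
bit-mono {false} a⇒b = z≤n
bit-mono {true}  a⇒b rewrite a⇒b refl = ℕ.≤-refl

count-mono-< : (c d : Fin n → Bool) → (∀ x → c x ≡ true → d x ≡ true) →
  ∀ x → c x ≡ false → d x ≡ true → count c < count d
count-mono-< c d c⇒d x ¬cx dx = sum-mono-< (bit ∘ c) (bit ∘ d) (λ y → bit-mono (c⇒d y)) x lt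
  where
  lt : bit (c x) < bit (d x)
  lt rewrite ¬cx | dx = ℕ.≤-refl

count-zero : (c : Fin n → Bool) → count c ≡ 0 → ∀ x → c x ≡ false
count-zero {n} c eq x with c x in cx
... | false = refl
... | true  = contradiction (subst (0 <_) eq pos) λ ()
  where
  pos : 0 < count c
  pos = subst (_< count c) (ℕΣ.sum-replicate-zero n)
    (count-mono-< (const false) c (λ _ ()) x refl cx)

count-cong : {c d : Fin n → Bool} → (∀ x → c x ≡ d x) → count c ≡ count d
count-cong c≡d = ℕΣ.sum-cong-≗ λ x → cong bit (c≡d x)

count-pop : ∀ {k} (c : Fin n → Bool) → count c ≡ suc k → ∃ λ x → c x ≡ true × count (c [ x ]≔ false) ≡ k
count-pop {suc n} c eq with c zero in c0
... | true  = zero , c0 , ℕ.suc-injective eq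
... | false with count-pop (c ∘ suc) eq
... | x , cx , eq′ = suc x , cx , trans (cong (λ b → bit b ℕ.+ count ((c ∘ suc) [ x ]≔ false)) c0) eq′

sum-χ : (c : Fin n → Bool) → sum (χ ∘ c) ≡ ℤ.+ count c
sum-χ {zero}  c = refl
sum-χ {suc n} c = trans (cong₂ _+_ (χ-bit (c zero)) (sum-χ (c ∘ suc))) (sym (ℤ.pos-+ (bit (c zero)) _))
  where
  χ-bit : ∀ b → χ b ≡ ℤ.+ bit b
  χ-bit true  = refl
  χ-bit false = refl

≔-true : (Y : Fin n → Bool) (y : Fin n) {x : Fin n} → (Y [ y ]≔ true) x ≡ true → x ≡ y ⊎ Y x ≡ true
≔-true Y y {x} Yx with x Fin.≟ y
... | yes x≡y = inj₁ x≡y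
... | no x≢y  = inj₂ (trans (sym (≔-≢ Y x≢y)) Yx)

≔-mono : (Y : Fin n → Bool) (y : Fin n) {x : Fin n} → Y x ≡ true → (Y [ y ]≔ true) x ≡ true
≔-mono Y y {x} Yx with x Fin.≟ y
... | yes refl = ≔-eq Y y
... | no x≢y   = trans (≔-≢ Y x≢y) Yx

-- One closure computation for residual graphs, supports of flows and alternating walks. `Inv` may
-- carry data, so each reached vertex can come with a labelling that records how it was reached; the
-- search ends because the complement shrinks.
grow : (Step : Fin n → Fin n → Set) → Decidable Step → (Inv : (Fin n → Bool) → Set) →
  (∀ Y x y → Inv Y → Y x ≡ true → Y y ≡ false → Step x y → Inv (Y [ y ]≔ true)) →
  ∀ Y → Inv Y →
  ∃ λ Z → Inv Z × (∀ x → Y x ≡ true → Z x ≡ true) × (∀ x y → Step x y → Z x ≡ true → Z y ≡ true)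
grow {n} Step step? Inv ext Y₀ inv₀ = go (suc (count (not ∘ Y₀))) Y₀ inv₀ ℕ.≤-refl
  where
  Result : (Fin n → Bool) → Set
  Result Y = ∃ λ Z → Inv Z × (∀ x → Y x ≡ true → Z x ≡ true) × (∀ x y → Step x y → Z x ≡ true → Z y ≡ true)
  go : ∀ k Y → Inv Y → count (not ∘ Y) < k → Result Y
  go (suc k) Y inv (s≤s le)
    with Fin.any? (λ x → Fin.any? (λ y → (Y x Bool.≟ true) ×-dec ((Y y Bool.≟ false) ×-dec step? x y)))
  ... | no stuck = Y , inv , (λ _ p → p) , closed
    where
    closed : ∀ x y → Step x y → Y x ≡ true → Y y ≡ true
    closed x y s Yx with Y y in Yy
    ... | true  = refl
    ... | false = contradiction (x , y , Yx , Yy , s) stuck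
  ... | yes (x , y , Yx , Yy , s)
    with go k (Y [ y ]≔ true) (ext Y x y inv Yx Yy s) (ℕ.<-≤-trans smaller le)
    where
    smaller : count (not ∘ (Y [ y ]≔ true)) < count (not ∘ Y)
    smaller = count-mono-< _ _
      (λ z p → cong not (back z (Bool.not-injective p))) y (cong not (≔-eq Y y)) (cong not Yy)
      where
      back : ∀ z → (Y [ y ]≔ true) z ≡ false → Y z ≡ false
      back z p with Y z in Yz
      ... | false = refl
      ... | true  = ⊥-elim (true≢false (≔-mono Y y Yz) p)
  ... | Z , invZ , sub , closed = Z , invZ , (λ z Yz → sub z (≔-mono Y y Yz)) , closed

-- Augmenting paths and contraction

δ-sym : (x y : Fin n) → δ x y ≡ δ y x
δ-sym x y with x Fin.≟ y
... | yes refl = refl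
... | no x≢y   = trans (δ-≢ x≢y) (sym (δ-≢ (x≢y ∘ sym)))

sum-dipole : (F : Fin n → ℤ) (c : ℤ) (u v : Fin n) →
  sum (λ x → F x * (c * (δ x v - δ x u))) ≡ c * (F v - F u)
sum-dipole F c u v = begin
  sum (λ x → F x * (c * (δ x v - δ x u)))
    ≡⟨ sum-cong-≗ (λ x → ring₁ (F x) c (δ x v) (δ x u)) ⟩
  sum (λ x → c * (F x * δ x v) + (- c) * (F x * δ x u))
    ≡⟨ ∑-distrib-+ (λ x → c * (F x * δ x v)) _ ⟩
  sum (λ x → c * (F x * δ x v)) + sum (λ x → (- c) * (F x * δ x u))
    ≡⟨ cong₂ _+_ (sym (*-distribˡ-sum c (λ x → F x * δ x v))) (sym (*-distribˡ-sum (- c) (λ x → F x * δ x u))) ⟩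
  c * sum (λ x → F x * δ x v) + (- c) * sum (λ x → F x * δ x u)
    ≡⟨ cong₂ (λ a b → c * a + (- c) * b) (sum-δ F v) (sum-δ F u) ⟩
  c * F v + (- c) * F u
    ≡⟨ ring₂ c (F v) (F u) ⟩
  c * (F v - F u) ∎
  where
  open ≡-Reasoning
  ring₁ : ∀ f c a b → f * (c * (a - b)) ≡ c * (f * a) + (- c) * (f * b)
  ring₁ = solve-∀
  ring₂ : ∀ c a b → c * a + (- c) * b ≡ c * (a - b)
  ring₂ = solve-∀

Link : Ends n m → Fin m → Fin n → Fin n → Set
Link es e x y = es e ≡ (x , y) ⊎ es e ≡ (y , x)

link? : (es : Ends n m) (e : Fin m) (x y : Fin n) → Dec (Link es e x y)
link? es e x y = (×.≡-dec Fin._≟_ Fin._≟_ (es e) (x , y)) ⊎-dec (×.≡-dec Fin._≟_ Fin._≟_ (es e) (y , x))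

link-sym : (es : Ends n m) {e : Fin m} {x y : Fin n} → Link es e x y → Link es e y x
link-sym es (inj₁ p) = inj₂ p
link-sym es (inj₂ p) = inj₁ p

link-both : (es : Ends n m) {e : Fin m} {x y : Fin n} (P : Fin n → Set) →
  Link es e x y → P x → P y → P (tl es e) × P (hd es e)
link-both es P (inj₁ eq) Px Py = subst (P ∘ proj₁) (sym eq) Px , subst (P ∘ proj₂) (sym eq) Py
link-both es P (inj₂ eq) Px Py = subst (P ∘ proj₁) (sym eq) Py , subst (P ∘ proj₂) (sym eq) Px

IsSign IsUnit : ℤ → Set
IsSign z = z ≡ 1ℤ ⊎ z ≡ -1ℤ
IsUnit z = z ≡ 0ℤ ⊎ IsSign z

bump : (Fin m → ℤ) → Fin m → ℤ → Fin m → ℤ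
bump φ e σ e′ = φ e′ + σ * δ e′ e

bump-eq : (φ : Fin m → ℤ) (e : Fin m) (σ : ℤ) → bump φ e σ e ≡ φ e + σ
bump-eq φ e σ = cong (φ e +_) (trans (cong (σ *_) (δ-refl e)) (ℤ.*-identityʳ σ))

bump-≢ : (φ : Fin m → ℤ) {e e′ : Fin m} (σ : ℤ) → e′ ≢ e → bump φ e σ e′ ≡ φ e′
bump-≢ φ {e′ = e′} σ e′≢e =
  trans (cong (φ e′ +_) (trans (cong (σ *_) (δ-≢ e′≢e)) (ℤ.*-zeroʳ σ))) (ℤ.+-identityʳ _)

∂-bump : ∀ κ (es : Ends n m) (φ : Fin m → ℤ) e σ x →
  ∂ κ es (bump φ e σ) x ≡ ∂ κ es φ x + σ * (δ x (hd es e) + κ * δ x (tl es e))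
∂-bump κ es φ e σ x = trans (∂-+ κ es φ (λ e′ → σ * δ e′ e) x)
  (cong (∂ κ es φ x +_) (trans (∂-* κ es σ (λ e′ → δ e′ e) x) (cong (σ *_) (∂-δ κ es e x))))

∂-bump-fwd : (es : Ends n m) (φ : Fin m → ℤ) {e : Fin m} {x y : Fin n} → es e ≡ (x , y) →
  ∀ z → ∂ -1ℤ es (bump φ e 1ℤ) z ≡ ∂ -1ℤ es φ z + (δ z y - δ z x)
∂-bump-fwd es φ {e} {x} {y} eq z = trans (∂-bump -1ℤ es φ e 1ℤ z)
  (trans (cong (λ p → ∂ -1ℤ es φ z + 1ℤ * (δ z (proj₂ p) + -1ℤ * δ z (proj₁ p))) eq)
         (ring (∂ -1ℤ es φ z) (δ z y) (δ z x)))
  where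
  ring : ∀ d a b → d + 1ℤ * (a + -1ℤ * b) ≡ d + (a - b)
  ring = solve-∀

∂-bump-bwd : (es : Ends n m) (φ : Fin m → ℤ) {e : Fin m} {x y : Fin n} → es e ≡ (y , x) →
  ∀ z → ∂ -1ℤ es (bump φ e -1ℤ) z ≡ ∂ -1ℤ es φ z + (δ z y - δ z x)
∂-bump-bwd es φ {e} {x} {y} eq z = trans (∂-bump -1ℤ es φ e -1ℤ z)
  (trans (cong (λ p → ∂ -1ℤ es φ z + -1ℤ * (δ z (proj₂ p) + -1ℤ * δ z (proj₁ p))) eq)
         (ring (∂ -1ℤ es φ z) (δ z x) (δ z y)))
  where
  ring : ∀ d a b → d + -1ℤ * (a + -1ℤ * b) ≡ d + (b - a)
  ring = solve-∀

∂-bump-link : (es : Ends n m) {e : Fin m} {x y : Fin n} → Link es e x y →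
  ∃ λ σ → IsSign σ × (∀ φ z → ∂ -1ℤ es (bump φ e σ) z ≡ ∂ -1ℤ es φ z + (δ z y - δ z x))
∂-bump-link es (inj₁ eq) = 1ℤ , inj₁ refl , λ φ → ∂-bump-fwd es φ eq
∂-bump-link es (inj₂ eq) = -1ℤ , inj₂ refl , λ φ → ∂-bump-bwd es φ eq

crosses : Ends n m → (Fin n → Bool) → Fin m → Bool
crosses es Y e = Y (tl es e) xor Y (hd es e)

record Unitary (es : Ends n m) (U : Fin m → Bool) (φ : Fin m → ℤ) : Set where
  field
    unit : ∀ e → IsUnit (φ e)
    off  : ∀ e → U e ≡ false → φ e ≡ 0ℤ

open Unitary

-- One augmenting path: otherwise the vertices reachable in the residual graph form a
-- cut of size exactly k.
augment : (es : Ends n m) (U : Fin m → Bool) (u v : Fin n) (k : ℕ) (φ : Fin m → ℤ) →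
  Unitary es U φ →
  (∀ x → ∂ -1ℤ es φ x ≡ ℤ.+ k * (δ x v - δ x u)) →
  (∀ Y → Y u ≡ true → Y v ≡ false → count (λ e → U e ∧ crosses es Y e) ≢ k) →
  ∃ λ φ′ → Unitary es U φ′ × (∀ x → ∂ -1ℤ es φ′ x ≡ ℤ.+ suc k * (δ x v - δ x u))
augment {n} {m} es U u v k φ Uφ ∂φ cuts = conclude (grow Residual residual? Inv extend Y₀ inv₀)
  where
  Passable : Fin m → Fin n → Fin n → Set
  Passable e x y = U e ≡ true × ((es e ≡ (x , y) × φ e ≢ 1ℤ) ⊎ (es e ≡ (y , x) × φ e ≢ -1ℤ))
  Residual : Fin n → Fin n → Set
  Residual x y = ∃ λ e → Passable e x y
  residual? : Decidable Residual
  residual? x y = Fin.any? λ e → (U e Bool.≟ true) ×-dec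
    ((×.≡-dec Fin._≟_ Fin._≟_ (es e) (x , y) ×-dec ¬? (φ e ℤ.≟ 1ℤ)) ⊎-dec
     (×.≡-dec Fin._≟_ Fin._≟_ (es e) (y , x) ×-dec ¬? (φ e ℤ.≟ -1ℤ)))
  record Reach (Y : Fin n → Bool) (x : Fin n) : Set where
    field
      flow     : Fin m → ℤ
      unitary  : Unitary es U flow
      boundary : ∀ z → ∂ -1ℤ es flow z ≡ ∂ -1ℤ es φ z + (δ z x - δ z u)
      inside   : ∀ e → flow e ≢ φ e → Y (tl es e) ≡ true × Y (hd es e) ≡ true
  Inv : (Fin n → Bool) → Set
  Inv Y = ∀ x → Y x ≡ true → Reach Y x
  Y₀ : Fin n → Bool
  Y₀ = const false [ u ]≔ true
  inv₀ : Inv Y₀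
  inv₀ x Yx with ≔-true (const false) u {x} Yx
  ... | inj₁ refl = record
    { flow = φ ; unitary = Uφ ; boundary = λ z → ring (∂ -1ℤ es φ z) (δ z u)
    ; inside = λ e ne → contradiction refl ne }
    where
    ring : ∀ d a → d ≡ d + (a - a)
    ring = solve-∀
  bumped : ∀ {Y x y e} σ → Reach Y x → Y x ≡ true → Y y ≡ false → U e ≡ true → Link es e x y →
    IsUnit (φ e + σ) →
    (∀ ψ z → ∂ -1ℤ es (bump ψ e σ) z ≡ ∂ -1ℤ es ψ z + (δ z y - δ z x)) →
    Reach (Y [ y ]≔ true) y
  bumped {Y} {x} {y} {e} σ r Yx Yy Ue link unitσ ∂bump = record
    { flow = ψ
    ; unitary = record { unit = unitψ ; off = offψ }
    ; boundary = λ z → trans (∂bump flow z) (trans (cong (_+ _) (boundary z))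
        (ring (∂ -1ℤ es φ z) (δ z x) (δ z u) (δ z y)))
    ; inside = insideψ }
    where
    open Reach r
    ψ : Fin m → ℤ
    ψ = bump flow e σ
    ring : ∀ d a b c → d + (a - b) + (c - a) ≡ d + (c - b)
    ring = solve-∀
    -- `Residual` tests the value of `φ`, not that of `flow`; they agree on `e` because its end `y`
    -- is still outside `Y`.
    unchanged : flow e ≡ φ e
    unchanged = decidable-stable (flow e ℤ.≟ φ e) λ ne → case link of λ where
      (inj₁ eq) → true≢false (proj₂ (inside e ne)) (trans (cong (Y ∘ proj₂) eq) Yy)
      (inj₂ eq) → true≢false (proj₁ (inside e ne)) (trans (cong (Y ∘ proj₁) eq) Yy)
    unitψ : ∀ e′ → IsUnit (ψ e′)
    unitψ e′ with e′ Fin.≟ e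
    ... | yes refl = subst IsUnit (sym (trans (bump-eq flow e σ) (cong (_+ σ) unchanged))) unitσ
    ... | no e′≢e  = subst IsUnit (sym (bump-≢ flow σ e′≢e)) (unit unitary e′)
    offψ : ∀ e′ → U e′ ≡ false → ψ e′ ≡ 0ℤ
    offψ e′ Ue′ with e′ Fin.≟ e
    ... | yes refl = ⊥-elim (true≢false Ue Ue′)
    ... | no e′≢e  = trans (bump-≢ flow σ e′≢e) (off unitary e′ Ue′)
    insideψ : ∀ e′ → ψ e′ ≢ φ e′ → (Y [ y ]≔ true) (tl es e′) ≡ true × (Y [ y ]≔ true) (hd es e′) ≡ true
    insideψ e′ ne with e′ Fin.≟ e
    ... | no e′≢e = let p , q = inside e′ (ne ∘ trans (bump-≢ flow σ e′≢e)) in ≔-mono Y y p , ≔-mono Y y q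
    ... | yes refl = link-both es (λ z → (Y [ y ]≔ true) z ≡ true) link (≔-mono Y y Yx) (≔-eq Y y)
  up : ∀ {z} → IsUnit z → z ≢ 1ℤ → IsUnit (z + 1ℤ)
  up (inj₁ refl)        ne = inj₂ (inj₁ refl)
  up (inj₂ (inj₁ refl)) ne = contradiction refl ne
  up (inj₂ (inj₂ refl)) ne = inj₁ refl
  down : ∀ {z} → IsUnit z → z ≢ -1ℤ → IsUnit (z + -1ℤ)
  down (inj₁ refl)        ne = inj₂ (inj₂ refl)
  down (inj₂ (inj₁ refl)) ne = inj₁ refl
  down (inj₂ (inj₂ refl)) ne = contradiction refl ne
  extend : ∀ Y x y → Inv Y → Y x ≡ true → Y y ≡ false → Residual x y → Inv (Y [ y ]≔ true)
  extend Y x y inv Yx Yy (e , Ue , pass) z Yz with ≔-true Y y Yz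
  ... | inj₂ Yz = record
    { flow = Reach.flow r ; unitary = Reach.unitary r ; boundary = Reach.boundary r
    ; inside = λ e ne → let p , q = Reach.inside r e ne in ≔-mono Y y p , ≔-mono Y y q }
    where r = inv z Yz
  extend Y x y inv Yx Yy (e , Ue , inj₁ (eq , ne)) z Yz | inj₁ refl =
    bumped 1ℤ (inv x Yx) Yx Yy Ue (inj₁ eq) (up (unit Uφ e) ne) (λ ψ → ∂-bump-fwd es ψ eq)
  extend Y x y inv Yx Yy (e , Ue , inj₂ (eq , ne)) z Yz | inj₁ refl =
    bumped -1ℤ (inv x Yx) Yx Yy Ue (inj₂ eq) (down (unit Uφ e) ne) (λ ψ → ∂-bump-bwd es ψ eq)

  conclude : (∃ λ Z → Inv Z × (∀ x → Y₀ x ≡ true → Z x ≡ true) ×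
    (∀ x y → Residual x y → Z x ≡ true → Z y ≡ true)) →
    ∃ λ φ′ → Unitary es U φ′ × (∀ x → ∂ -1ℤ es φ′ x ≡ ℤ.+ suc k * (δ x v - δ x u))
  conclude (Z , inv , sub , closed) with Z v in Zv
  ... | true = flow , unitary , λ z → trans (boundary z) (trans (cong (_+ _) (∂φ z))
                  (ring (ℤ.+ k) (δ z v - δ z u)))
    where
    open Reach (inv v Zv)
    ring : ∀ k d → k * d + d ≡ (1ℤ + k) * d
    ring = solve-∀
  ... | false = contradiction (ℤ.+-injective (ℤ.neg-injective (trans (sym edgewise) vertexwise)))
                  (cuts Z Zu Zv)
    where
    open ≡-Reasoning
    Zu : Z u ≡ true
    Zu = sub u (≔-eq (const false) u)
    cut : Fin m → Bool
    cut e = U e ∧ crosses es Z e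
    ring : ∀ k → k * (0ℤ - 1ℤ) ≡ - k
    ring = solve-∀
    vertexwise : sum (λ x → χ (Z x) * ∂ -1ℤ es φ x) ≡ - (ℤ.+ k)
    vertexwise = begin
      sum (λ x → χ (Z x) * ∂ -1ℤ es φ x)
        ≡⟨ sum-cong-≗ (λ x → cong (χ (Z x) *_) (∂φ x)) ⟩
      sum (λ x → χ (Z x) * (ℤ.+ k * (δ x v - δ x u)))
        ≡⟨ sum-dipole (χ ∘ Z) (ℤ.+ k) u v ⟩
      ℤ.+ k * (χ (Z v) - χ (Z u))
        ≡⟨ cong₂ (λ a b → ℤ.+ k * (χ a - χ b)) Zv Zu ⟩
      ℤ.+ k * (0ℤ - 1ℤ)
        ≡⟨ ring (ℤ.+ k) ⟩
      - (ℤ.+ k) ∎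
    -- An edge of `U` leaving `Z` carries 1 outwards, since otherwise its outer end would be
    -- reachable too; so the net flow out of `Z` counts the cut.
    saturated : ∀ e → φ e * (χ (Z (hd es e)) + -1ℤ * χ (Z (tl es e))) ≡ -1ℤ * χ (cut e)
    saturated e with U e in Ue | Z (tl es e) in Zt | Z (hd es e) in Zh
    ... | false | t | h = cong (_* (χ h + -1ℤ * χ t)) (off Uφ e Ue)
    ... | true | true  | true  = ℤ.*-zeroʳ (φ e)
    ... | true | false | false = ℤ.*-zeroʳ (φ e)
    ... | true | true  | false = cong (_* -1ℤ) (decidable-stable (φ e ℤ.≟ 1ℤ)
            λ ne → true≢false (closed _ _ (e , Ue , inj₁ (refl , ne)) Zt) Zh)
    ... | true | false | true  = cong (_* 1ℤ) (decidable-stable (φ e ℤ.≟ -1ℤ)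
            λ ne → true≢false (closed _ _ (e , Ue , inj₂ (refl , ne)) Zh) Zt)
    edgewise : sum (λ x → χ (Z x) * ∂ -1ℤ es φ x) ≡ - (ℤ.+ count cut)
    edgewise = begin
      sum (λ x → χ (Z x) * ∂ -1ℤ es φ x)
        ≡⟨ pairing -1ℤ es (χ ∘ Z) φ ⟩
      sum (λ e → φ e * (χ (Z (hd es e)) + -1ℤ * χ (Z (tl es e))))
        ≡⟨ sum-cong-≗ saturated ⟩
      sum (λ e → -1ℤ * χ (cut e))
        ≡⟨ sym (*-distribˡ-sum -1ℤ (χ ∘ cut)) ⟩
      -1ℤ * sum (χ ∘ cut)
        ≡⟨ cong (-1ℤ *_) (sum-χ cut) ⟩
      -1ℤ * ℤ.+ count cut
        ≡⟨ ℤ.-1*i≡-i _ ⟩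
      - (ℤ.+ count cut) ∎

collapse : (Fin n → Bool) → Fin n → Fin n → Fin n
collapse Y s x = if Y x then s else x

contract : (Fin n → Bool) → Fin n → Ends n m → Ends n m
contract Y s es e = collapse Y s (tl es e) , collapse Y s (hd es e)

-- J y carries the excess of f at y ∈ Y to the vertex to which Y is contracted.
lift : Ends n m → (Fin n → Bool) → (Fin n → Fin m → ℤ) → (Fin m → ℤ) → Fin m → ℤ
lift es Y J f e = f e + sum λ y → - (χ (Y y) * ∂ -1ℤ es f y) * J y e

lift-off : (es : Ends n m) (Y : Fin n → Bool) (J : Fin n → Fin m → ℤ) (f : Fin m → ℤ) (e : Fin m) →
  (∀ y → Y y ≡ true → J y e ≡ 0ℤ) → lift es Y J f e ≡ f e
lift-off es Y J f e J≡0 = trans (cong (f e +_) (sum-0 _ term)) (ℤ.+-identityʳ _)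
  where
  term : ∀ y → - (χ (Y y) * ∂ -1ℤ es f y) * J y e ≡ 0ℤ
  term y with Y y in Yy
  ... | false = ℤ.*-zeroˡ (J y e)
  ... | true  = trans (cong (- (1ℤ * ∂ -1ℤ es f y) *_) (J≡0 y Yy)) (ℤ.*-zeroʳ (- (1ℤ * ∂ -1ℤ es f y)))

-- The correction moves the excess at each vertex of `Y` to `s`, just as contraction does. Formally,
-- both sides pair the boundary of `f` with the indicator of the vertices that collapse to `x`.
∂-lift : (es : Ends n m) (Y : Fin n → Bool) (s : Fin n) (J : Fin n → Fin m → ℤ) →
  (∀ y → Y y ≡ true → ∀ x → ∂ -1ℤ es (J y) x ≡ δ x y - δ x s) →
  ∀ f x → ∂ -1ℤ es (lift es Y J f) x ≡ ∂ -1ℤ (contract Y s es) f x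
∂-lift {n} {m} es Y s J ∂J f x = begin
  ∂ -1ℤ es (lift es Y J f) x
    ≡⟨ ∂-+ -1ℤ es f (λ e → sum λ y → c y * J y e) x ⟩
  D x + ∂ -1ℤ es (λ e → sum λ y → c y * J y e) x
    ≡⟨ cong (D x +_) (trans (∂-sum -1ℤ es (λ y e → c y * J y e) x) (sum-cong-≗ λ y → ∂-* -1ℤ es (c y) (J y) x)) ⟩
  D x + sum (λ y → c y * ∂ -1ℤ es (J y) x)
    ≡⟨ cong (_+ sum (λ y → c y * ∂ -1ℤ es (J y) x)) (sym (sum-δ D x)) ⟩
  sum (λ y → D y * δ y x) + sum (λ y → c y * ∂ -1ℤ es (J y) x)
    ≡⟨ sym (∑-distrib-+ (λ y → D y * δ y x) _) ⟩
  sum (λ y → D y * δ y x + c y * ∂ -1ℤ es (J y) x)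
    ≡⟨ sum-cong-≗ term ⟩
  sum (λ y → δ x (collapse Y s y) * D y)
    ≡⟨ pairing -1ℤ es (λ y → δ x (collapse Y s y)) f ⟩
  ∂ -1ℤ (contract Y s es) f x ∎
  where
  open ≡-Reasoning
  D c : Fin n → ℤ
  D = ∂ -1ℤ es f
  c y = - (χ (Y y) * D y)
  ring₁ : ∀ d a b → d * a + - (1ℤ * d) * (a - b) ≡ b * d
  ring₁ = solve-∀
  ring₂ : ∀ d a j → d * a + 0ℤ * j ≡ a * d
  ring₂ = solve-∀
  term : ∀ y → D y * δ y x + c y * ∂ -1ℤ es (J y) x ≡ δ x (collapse Y s y) * D y
  term y with Y y in Yy
  ... | true  = trans (cong₂ (λ a b → D y * a + - (1ℤ * D y) * b) (δ-sym y x) (∂J y Yy x)) (ring₁ (D y) (δ x y) (δ x s))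
  ... | false = trans (cong (λ a → D y * a + 0ℤ * ∂ -1ℤ es (J y) x) (δ-sym y x)) (ring₂ (D y) (δ x y) (∂ -1ℤ es (J y) x))

-- Parity, and the component of a support

2ℤ : ℤ
2ℤ = ℤ.+ 2

Odd : ℤ → Set
Odd z = ¬ 2ℤ ∣ z

2∣0 : 2ℤ ∣ 0ℤ
2∣0 = divides 0ℤ refl

2∤1 : Odd 1ℤ
2∤1 = from-yes (¬? (2ℤ ∣? 1ℤ))

sign-odd : ∀ {z} → IsSign z → Odd z
sign-odd (inj₁ refl) = 2∤1
sign-odd (inj₂ refl) = from-yes (¬? (2ℤ ∣? -1ℤ))

unit-odd : ∀ {z} → IsUnit z → z ≢ 0ℤ → Odd z
unit-odd (inj₁ z≡0) z≢0 = contradiction z≡0 z≢0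
unit-odd (inj₂ s)   z≢0 = sign-odd s

even-sum : (f : Fin n → ℤ) → (∀ x → 2ℤ ∣ f x) → 2ℤ ∣ sum f
even-sum {zero}  f even = 2∣0
even-sum {suc n} f even = ∣m∣n⇒∣m+n (even zero) (even-sum (f ∘ suc) (even ∘ suc))

if-χ : (b : Bool) {z : ℤ} → (b ≡ false → z ≡ 0ℤ) → χ b * z ≡ z
if-χ true  _ = ℤ.*-identityˡ _
if-χ false p = sym (p refl)

χ-true : ∀ b → χ b ≡ 1ℤ → b ≡ true
χ-true true _ = refl

-- Y is the component of u in the support of φ, and J y carries one unit from u to y in it.
record Component (es : Ends n m) (X : Fin n → Bool) (φ : Fin m → ℤ) (u : Fin n) : Set where
  field
    Y      : Fin n → Bool
    u∈Y    : Y u ≡ true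
    Y⊆X    : ∀ y → Y y ≡ true → X y ≡ true
    closed : ∀ e → φ e ≢ 0ℤ → Y (tl es e) ≡ Y (hd es e)
    J      : Fin n → Fin m → ℤ
    ∂J     : ∀ y → Y y ≡ true → ∀ x → ∂ -1ℤ es (J y) x ≡ δ x y - δ x u
    J⊆     : ∀ y → Y y ≡ true → ∀ e → J y e ≢ 0ℤ → φ e ≢ 0ℤ × Y (tl es e) ≡ true × Y (hd es e) ≡ true

component : (es : Ends n m) (X : Fin n → Bool) (φ : Fin m → ℤ) (u : Fin n) → X u ≡ true →
  (∀ e → φ e ≢ 0ℤ → X (tl es e) ≡ true × X (hd es e) ≡ true) → Component es X φ u
component {n} {m} es X φ u Xu φ⊆X = conclude (grow Step step? Inv extend Y₀ inv₀)
  where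
  Step : Fin n → Fin n → Set
  Step x y = ∃ λ e → φ e ≢ 0ℤ × Link es e x y
  step? : Decidable Step
  step? x y = Fin.any? λ e → ¬? (φ e ℤ.≟ 0ℤ) ×-dec link? es e x y
  Ok : (Fin n → Bool) → (Fin m → ℤ) → Fin n → Set
  Ok Y j y = X y ≡ true × (∀ x → ∂ -1ℤ es j x ≡ δ x y - δ x u) ×
    (∀ e → j e ≢ 0ℤ → φ e ≢ 0ℤ × Y (tl es e) ≡ true × Y (hd es e) ≡ true)
  Inv : (Fin n → Bool) → Set
  Inv Y = ∃ λ (J : Fin n → Fin m → ℤ) → ∀ y → Y y ≡ true → Ok Y (J y) y
  Y₀ : Fin n → Bool
  Y₀ = const false [ u ]≔ true
  inv₀ : Inv Y₀
  inv₀ = (λ _ _ → 0ℤ) , ok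
    where
    ok : ∀ y → Y₀ y ≡ true → Ok Y₀ (const 0ℤ) y
    ok y Yy with ≔-true (const false) u {y} Yy
    ... | inj₁ refl = Xu , (λ x → trans (∂-0 -1ℤ es x) (sym (ℤ.+-inverseʳ (δ x y)))) , λ e ne → contradiction refl ne
  extend : ∀ Y x y → Inv Y → Y x ≡ true → Y y ≡ false → Step x y → Inv (Y [ y ]≔ true)
  extend Y x y (J , ok) Yx Yy (e , φe , link) = (J [ y ]≔ bump (J x) e σ) , ok′
    where
    σ = proj₁ (∂-bump-link es link)
    ∂bump = proj₂ (proj₂ (∂-bump-link es link))
    Y′ = Y [ y ]≔ true
    ring : ∀ a b c → (a - b) + (c - a) ≡ c - b
    ring = solve-∀
    new : Ok Y′ (bump (J x) e σ) y
    new =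
        end
      , (λ z → trans (∂bump (J x) z) (trans (cong (_+ (δ z y - δ z x)) (proj₁ (proj₂ (ok x Yx)) z)) (ring (δ z x) (δ z u) (δ z y))))
      , supp
      where
      end : X y ≡ true
      end = case link of λ where
        (inj₁ eq) → subst (λ p → X (proj₂ p) ≡ true) eq (proj₂ (φ⊆X e φe))
        (inj₂ eq) → subst (λ p → X (proj₁ p) ≡ true) eq (proj₁ (φ⊆X e φe))
      supp : ∀ e′ → bump (J x) e σ e′ ≢ 0ℤ → φ e′ ≢ 0ℤ × Y′ (tl es e′) ≡ true × Y′ (hd es e′) ≡ true
      supp e′ ne with e′ Fin.≟ e
      ... | yes refl = φe , link-both es (λ z → Y′ z ≡ true) link (≔-mono Y y Yx) (≔-eq Y y)
      ... | no e′≢e  = let p , q , r = proj₂ (proj₂ (ok x Yx)) e′ (ne ∘ trans (bump-≢ (J x) σ e′≢e))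
                       in p , ≔-mono Y y q , ≔-mono Y y r
    ok′ : ∀ z → Y′ z ≡ true → Ok Y′ ((J [ y ]≔ bump (J x) e σ) z) z
    ok′ z Y′z with z Fin.≟ y
    ... | yes refl = subst (λ j → Ok Y′ j z) (sym (≔-eq J z)) new
    ... | no z≢y   = let a , b , c = ok z (trans (sym (≔-≢ Y z≢y)) Y′z) in
      subst (λ j → Ok Y′ j z) (sym (≔-≢ J z≢y))
        (a , b , λ e′ ne → let p , q , r = c e′ ne in p , ≔-mono Y y q , ≔-mono Y y r)
  conclude : (∃ λ Z → Inv Z × (∀ x → Y₀ x ≡ true → Z x ≡ true) ×
    (∀ x y → Step x y → Z x ≡ true → Z y ≡ true)) → Component es X φ u
  conclude (Z , (J , ok) , sub , clo) = record
    { Y = Z ; u∈Y = sub u (≔-eq (const false) u) ; Y⊆X = λ y Zy → proj₁ (ok y Zy)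
    ; closed = closed ; J = J ; ∂J = λ y Zy → proj₁ (proj₂ (ok y Zy))
    ; J⊆ = λ y Zy → proj₂ (proj₂ (ok y Zy)) }
    where
    closed : ∀ e → φ e ≢ 0ℤ → Z (tl es e) ≡ Z (hd es e)
    closed e φe with Z (tl es e) in Zt | Z (hd es e) in Zh
    ... | true  | true  = refl
    ... | false | false = refl
    ... | true  | false = ⊥-elim (true≢false (clo _ _ (e , φe , inj₁ refl) Zt) Zh)
    ... | false | true  = ⊥-elim (true≢false (clo _ _ (e , φe , inj₂ refl) Zh) Zt)

module _ (es : Ends n m) {X : Fin n → Bool} {φ : Fin m → ℤ} {u : Fin n} (K : Component es X φ u) where
  open Component K

  -- The restriction of `φ` to the component: edges of the support do not leave `Y`, so testing the
  -- tail is enough.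
  part : Fin m → ℤ
  part e = χ (Y (tl es e)) * φ e

  ∂-part : ∀ x → ∂ -1ℤ es part x ≡ χ (Y x) * ∂ -1ℤ es φ x
  ∂-part x = trans (sum-cong-≗ term) (sym (*-distribˡ-sum (χ (Y x)) (λ e → φ e * (δ x (hd es e) + -1ℤ * δ x (tl es e)))))
    where
    ring : ∀ a b c → a * b * c ≡ a * (b * c)
    ring = solve-∀
    term : ∀ e → part e * (δ x (hd es e) + -1ℤ * δ x (tl es e)) ≡ χ (Y x) * (φ e * (δ x (hd es e) + -1ℤ * δ x (tl es e)))
    term e with φ e ℤ.≟ 0ℤ | x Fin.≟ tl es e | x Fin.≟ hd es e
    ... | yes φ≡0 | _ | _ rewrite φ≡0 =
      trans (cong (_* (δ x (hd es e) + -1ℤ * δ x (tl es e))) (ℤ.*-zeroʳ (χ (Y (tl es e))))) (sym (ℤ.*-zeroʳ (χ (Y x))))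
    ... | no _ | yes refl | _ = ring (χ (Y x)) (φ e) _
    ... | no φ≢0 | no _ | yes refl rewrite closed e φ≢0 = ring (χ (Y x)) (φ e) _
    ... | no _ | no x≢t | no x≢h rewrite δ-≢ x≢t | δ-≢ x≢h =
      trans (ℤ.*-zeroʳ (part e)) (sym (trans (cong (χ (Y x) *_) (ℤ.*-zeroʳ (φ e))) (ℤ.*-zeroʳ (χ (Y x)))))

  -- No edge of the support leaves `Y`, so the total excess in `Y` is zero; the deficit of 2 at `u`
  -- must therefore be balanced by `v` inside `Y`.
  component-∋ : ∀ v → (∀ x → ∂ -1ℤ es φ x ≡ 2ℤ * (δ x v - δ x u)) → Y v ≡ true
  component-∋ v ∂φ = χ-true (Y v) (trans (ℤ.i-j≡0⇒i≡j _ _ (ℤ.*-cancelˡ-≡ 2ℤ _ _ vertexwise)) (cong χ u∈Y))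
    where
    edgewise : sum (λ x → χ (Y x) * ∂ -1ℤ es φ x) ≡ 0ℤ
    edgewise = trans (pairing -1ℤ es (χ ∘ Y) φ) (sum-0 _ term)
      where
      ring : ∀ a b → a * (b + -1ℤ * b) ≡ 0ℤ
      ring = solve-∀
      term : ∀ e → φ e * (χ (Y (hd es e)) + -1ℤ * χ (Y (tl es e))) ≡ 0ℤ
      term e with φ e ℤ.≟ 0ℤ
      ... | yes φ≡0 rewrite φ≡0 = refl
      ... | no φ≢0 rewrite closed e φ≢0 = ring (φ e) (χ (Y (hd es e)))
    vertexwise : 2ℤ * (χ (Y v) - χ (Y u)) ≡ 2ℤ * 0ℤ
    vertexwise = trans (sym (sum-dipole (χ ∘ Y) 2ℤ u v))
      (trans (sum-cong-≗ λ x → cong (χ (Y x) *_) (sym (∂φ x))) edgewise)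

-- Edge cuts

-- Exhaustive search up to `≈`. Asking only for predicates that respect `≈` lets it extend to
-- functions compared pointwise, without extensionality, and to integers modulo `k`, an infinite
-- carrier.
Search : (A : Set) → (A → A → Set) → Set₁
Search A _≈_ = (P : A → Set) → (∀ {x y} → x ≈ y → P x → P y) → (∀ x → Dec (P x)) → Dec (∃ P)

search-Bool : Search Bool _≡_
search-Bool P resp P? with P? false | P? true
... | yes p | _     = yes (false , p)
... | no _  | yes q = yes (true , q)
... | no ¬p | no ¬q = no λ { (false , p) → ¬p p ; (true , q) → ¬q q }

search-Vector : {A : Set} {_≈_ : A → A → Set} → (∀ {x} → x ≈ x) → Search A _≈_ →
  ∀ n → Search (Vector A n) (λ f g → ∀ i → f i ≈ g i)
search-Vector ≈-refl search zero P resp P? =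
  map′ (λ p → Vector.[] , p) (λ (f , p) → resp (λ ()) p) (P? Vector.[])
search-Vector {A} ≈-refl search (suc n) P resp P? = map′
  (λ (x , f , p) → (x Vector.∷ f) , p)
  (λ (f , p) → f zero , f ∘ suc , resp (λ { zero → ≈-refl ; (suc i) → ≈-refl }) p)
  (search (λ x → ∃ λ f → P (x Vector.∷ f))
    (λ x≈y (f , p) → f , resp (λ { zero → x≈y ; (suc i) → ≈-refl }) p)
    (λ x → search-Vector ≈-refl search n (λ f → P (x Vector.∷ f))
      (λ f≈g → resp λ { zero → ≈-refl ; (suc i) → f≈g i }) (λ f → P? (x Vector.∷ f))))

all-Bool? : {P : Bool → Set} → (∀ b → Dec (P b)) → Dec (∀ b → P b)
all-Bool? P? with P? false | P? true
... | yes p | yes q = yes λ { false → p ; true → q }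
... | no ¬p | _     = no λ f → ¬p (f false)
... | _     | no ¬q = no λ f → ¬q (f true)

NoSmallCut : Ends n m → Set
NoSmallCut es = ∀ Y → count (crosses es Y) ≢ 1 × count (crosses es Y) ≢ 2

count-pos : (c : Fin n → Bool) {e : Fin n} → c e ≡ true → 1 ≤ count c
count-pos c {e} ce with count c in eq
... | zero  = ⊥-elim (true≢false ce (count-zero c eq e))
... | suc _ = s≤s z≤n

count-distrib-+ : (c d : Fin n → Bool) → count c ℕ.+ count d ≡ ℕΣ.sum (λ e → bit (c e) ℕ.+ bit (d e))
count-distrib-+ c d = sym (ℕΣ.∑-distrib-+ (bit ∘ c) (bit ∘ d))

-- The two kinds of edges leaving X ∌ s, from the values of X (a, b) and of
-- "is s" (p, q) at their ends.
toRoot toOther : (a b p q : Bool) → Bool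
toRoot  a b p q = (a ∧ q) ∨ (b ∧ p)
toOther a b p q = (a ∧ not b ∧ not q) ∨ (b ∧ not a ∧ not p)

xor-split : ∀ a b p q → a ∧ p ≡ false → b ∧ q ≡ false →
  bit (a xor b) ≡ bit (toRoot a b p q) ℕ.+ bit (toOther a b p q)
xor-split = from-yes (all-Bool? λ a → all-Bool? λ b → all-Bool? λ p → all-Bool? λ q →
  (a ∧ p Bool.≟ false) →-dec ((b ∧ q Bool.≟ false) →-dec
    (bit (a xor b) ℕ.≟ bit (toRoot a b p q) ℕ.+ bit (toOther a b p q))))

-- When a set is halved, an edge that left it for a vertex other than the root still leaves exactly
-- one half, while an inner edge between the halves leaves both: hence the last summand appears
-- twice.
toOther-split : ∀ a b y z p q → a ∧ p ≡ false → b ∧ q ≡ false →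
  bit (toOther (a ∧ y) (b ∧ z) p q) ℕ.+ bit (toOther (a ∧ not y) (b ∧ not z) p q) ≡
  bit (toOther a b p q) ℕ.+ (bit ((a ∧ b) ∧ (y xor z)) ℕ.+ bit ((a ∧ b) ∧ (y xor z)))
toOther-split = from-yes (all-Bool? λ a → all-Bool? λ b → all-Bool? λ y → all-Bool? λ z →
  all-Bool? λ p → all-Bool? λ q → (a ∧ p Bool.≟ false) →-dec ((b ∧ q Bool.≟ false) →-dec
    (bit (toOther (a ∧ y) (b ∧ z) p q) ℕ.+ bit (toOther (a ∧ not y) (b ∧ not z) p q) ℕ.≟
     bit (toOther a b p q) ℕ.+ (bit ((a ∧ b) ∧ (y xor z)) ℕ.+ bit ((a ∧ b) ∧ (y xor z))))))

∧-true : ∀ {a b} → a ∧ b ≡ true → a ≡ true × b ≡ true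
∧-true {true} {true} _ = refl , refl

module Rooted (es : Ends n m) (s : Fin n) where

  isRoot : Fin n → Bool
  isRoot x = does (x Fin.≟ s)

  isRoot-true : ∀ {x} → isRoot x ≡ true → x ≡ s
  isRoot-true {x} p with x Fin.≟ s
  ... | yes x≡s = x≡s

  rootEdge otherEdge : (Fin n → Bool) → Fin m → Bool
  rootEdge  X e = toRoot  (X (tl es e)) (X (hd es e)) (isRoot (tl es e)) (isRoot (hd es e))
  otherEdge X e = toOther (X (tl es e)) (X (hd es e)) (isRoot (tl es e)) (isRoot (hd es e))

  within : (Fin n → Bool) → Fin m → Bool
  within X e = X (tl es e) ∧ X (hd es e)

  avoids : {X : Fin n → Bool} → X s ≡ false → ∀ x → X x ∧ isRoot x ≡ false
  avoids {X} Xs x with x Fin.≟ s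
  ... | yes refl = cong (_∧ true) Xs
  ... | no _     = Bool.∧-zeroʳ (X x)

  rootEdge-link : ∀ {X e u} → Link es e u s → X u ≡ true → rootEdge X e ≡ true
  rootEdge-link {X} (inj₁ eq) Xu rewrite eq | Xu | dec-true (s Fin.≟ s) refl = refl
  rootEdge-link {X} (inj₂ eq) Xu rewrite eq | Xu | dec-true (s Fin.≟ s) refl = Bool.∨-zeroʳ _

  link-rootEdge : ∀ {X e} → rootEdge X e ≡ true → ∃ λ u → X u ≡ true × Link es e u s
  link-rootEdge {X} {e} p with X (tl es e) ∧ isRoot (hd es e) in r
  ... | true  = let Xt , h = ∧-true r in tl es e , Xt , inj₁ (cong (tl es e ,_) (isRoot-true h))
  ... | false = let Xh , t = ∧-true p in hd es e , Xh , inj₂ (cong (_, hd es e) (isRoot-true t))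

  crosses-split : ∀ X → X s ≡ false → count (crosses es X) ≡ count (rootEdge X) ℕ.+ count (otherEdge X)
  crosses-split X Xs = trans
    (ℕΣ.sum-cong-≗ λ e → xor-split (X (tl es e)) (X (hd es e)) _ _ (avoids Xs (tl es e)) (avoids Xs (hd es e)))
    (sym (count-distrib-+ (rootEdge X) (otherEdge X)))

  -- The bound 1 on `other` is forced from both sides. Cuts have at least 3 edges, so 3 - 1 = 2 of
  -- them reach the root; and 1 + 2 * 1 < 2 + 2 is what makes one of two halves good again in
  -- `separation`.
  record Good (X : Fin n → Bool) : Set where
    field
      s∉X   : X s ≡ false
      root  : 2 ≤ count (rootEdge X)
      other : count (otherEdge X) ≤ 1

  open Good

  good-resp : {X X′ : Fin n → Bool} → (∀ x → X x ≡ X′ x) → Good X → Good X′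
  good-resp {X} {X′} eq g = record
    { s∉X   = trans (sym (eq s)) (s∉X g)
    ; root  = subst (2 ≤_) (count-cong {c = rootEdge X} {rootEdge X′} λ e → cong₂ (λ a b → toRoot a b (isRoot (tl es e)) (isRoot (hd es e))) (eq (tl es e)) (eq (hd es e))) (root g)
    ; other = subst (_≤ 1) (count-cong {c = otherEdge X} {otherEdge X′} λ e → cong₂ (λ a b → toOther a b (isRoot (tl es e)) (isRoot (hd es e))) (eq (tl es e)) (eq (hd es e))) (other g) }

  good? : ∀ X → Dec (Good X)
  good? X = map′ (λ (a , b , c) → record { s∉X = a ; root = b ; other = c }) (λ g → s∉X g , root g , other g)
    ((X s Bool.≟ false) ×-dec ((2 ℕ.≤? count (rootEdge X)) ×-dec (count (otherEdge X) ℕ.≤? 1)))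

  Minimal : (Fin n → Bool) → Set
  Minimal X = ∀ X′ → Good X′ → ¬ count X′ < count X

  minimal-good : ∀ X → Good X → ∃ λ X′ → Good X′ × Minimal X′
  minimal-good X g = go (suc (count X)) X g ℕ.≤-refl
    where
    go : ∀ k X → Good X → count X < k → ∃ λ X′ → Good X′ × Minimal X′
    go (suc k) X g (s≤s le) with search-Vector refl search-Bool n (λ X′ → Good X′ × count X′ < count X)
      (λ eq (g , lt) → good-resp eq g , subst (_< count X) (count-cong eq) lt)
      (λ X′ → good? X′ ×-dec (count X′ ℕ.<? count X))
    ... | yes (X′ , g′ , lt) = go k X′ g′ (ℕ.<-≤-trans lt le)
    ... | no none            = X , g , λ X′ g′ lt → none (X′ , g′ , lt)

  module _ (noSmall : NoSmallCut es) where

    large : ∀ Y {e} → crosses es Y e ≡ true → 3 ≤ count (crosses es Y)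
    large Y {e} cross with count (crosses es Y) | count-pos (crosses es Y) {e} cross | noSmall Y
    ... | 1                 | _ | ne , _ = contradiction refl ne
    ... | 2                 | _ | _ , ne = contradiction refl ne
    ... | suc (suc (suc k)) | _ | _      = s≤s (s≤s (s≤s z≤n))

    complement-good : ∀ e x → x ≢ s → Link es e x s → Good (not ∘ isRoot)
    complement-good e x x≢s link = record
      { s∉X = Xs
      ; root = ℕ.≤-trans (ℕ.n≤1+n 2) (subst (3 ≤_) total (large X cross))
      ; other = subst (_≤ 1) (sym no-other) z≤n }
      where
      X = not ∘ isRoot
      Xs : X s ≡ false
      Xs = cong not (dec-true (s Fin.≟ s) refl)
      Xx : X x ≡ true
      Xx = cong not (dec-false (x Fin.≟ s) x≢s)
      cross : crosses es X e ≡ true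
      cross = case link of λ where
        (inj₁ eq) → trans (cong (λ p → X (proj₁ p) xor X (proj₂ p)) eq) (cong₂ _xor_ Xx Xs)
        (inj₂ eq) → trans (cong (λ p → X (proj₁ p) xor X (proj₂ p)) eq) (cong₂ _xor_ Xs Xx)
      none : ∀ p q → toOther (not p) (not q) p q ≡ false
      none = from-yes (all-Bool? λ p → all-Bool? λ q → toOther (not p) (not q) p q Bool.≟ false)
      no-other : count (otherEdge X) ≡ 0
      no-other = trans (count-cong {d = const false} λ e → none (isRoot (tl es e)) (isRoot (hd es e)))
                       (ℕΣ.sum-replicate-zero m)
      total : count (crosses es X) ≡ count (rootEdge X)
      total = trans (crosses-split X Xs) (trans (cong (count (rootEdge X) ℕ.+_) no-other) (ℕ.+-identityʳ _))

    module _ {X : Fin n → Bool} (g : Good X) (minimal : Minimal X) where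

      not-smaller : ∀ W {e u} w → (∀ x → W x ≡ true → X x ≡ true) → X w ≡ true → W w ≡ false →
        W u ≡ true → Link es e u s → ¬ count (otherEdge W) ≤ 1
      not-smaller W {e} {u} w W⊆X Xw Ww Wu link other≤1 =
        minimal W (record { s∉X = Ws ; root = enough ; other = other≤1 }) (count-mono-< W X W⊆X w Ww Xw)
        where
        Ws : W s ≡ false
        Ws with W s in eq
        ... | false = refl
        ... | true  = ⊥-elim (true≢false (W⊆X s eq) (s∉X g))
        cross : crosses es W e ≡ true
        cross = case link of λ where
          (inj₁ eq) → trans (cong (λ p → W (proj₁ p) xor W (proj₂ p)) eq) (cong₂ _xor_ Wu Ws)
          (inj₂ eq) → trans (cong (λ p → W (proj₁ p) xor W (proj₂ p)) eq) (cong₂ _xor_ Ws Wu)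
        -- Since `e` crosses `W`, the cut is nonempty and so has at least three edges, of which at
        -- most one avoids the root.
        enough : 2 ≤ count (rootEdge W)
        enough = ℕ.+-cancelʳ-≤ 1 2 _ (ℕ.≤-trans (large W cross)
          (subst (_≤ count (rootEdge W) ℕ.+ 1) (sym (crosses-split W Ws)) (ℕ.+-monoʳ-≤ (count (rootEdge W)) other≤1)))

      -- If at most one inner edge crossed `Y`, the two halves of `X` would have at most 1 + 2 * 1
      -- other edges together, so one half would have at most one. That half is a smaller good set,
      -- as each half contains one of `u` and `v` and thus has an edge to `s`.
      separation : ∀ {a b u v} → X u ≡ true → X v ≡ true → Link es a u s → Link es b v s →
        ∀ Y → Y u ≡ true → Y v ≡ false → 2 ≤ count (λ e → within X e ∧ crosses es Y e)
      separation {a} {b} {u} {v} Xu Xv linkᵤ linkᵥ Y Yu Yv with 2 ℕ.≤? count (λ e → within X e ∧ crosses es Y e)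
      ... | yes ok = ok
      ... | no ¬ok = ⊥-elim (ℕ.<-irrefl refl (ℕ.≤-trans (ℕ.+-mono-≤ (ℕ.≰⇒> side₁) (ℕ.≰⇒> side₂)) total))
        where
        W₁ W₂ : Fin n → Bool
        W₁ x = X x ∧ Y x
        W₂ x = X x ∧ not (Y x)
        few : count (λ e → within X e ∧ crosses es Y e) ≤ 1
        few = ℕ.≤-pred (ℕ.≰⇒> ¬ok)
        side₁ : ¬ count (otherEdge W₁) ≤ 1
        side₁ = not-smaller W₁ v (λ x p → proj₁ (∧-true p)) Xv (cong₂ _∧_ Xv Yv) (cong₂ _∧_ Xu Yu) linkᵤ
        side₂ : ¬ count (otherEdge W₂) ≤ 1
        side₂ = not-smaller W₂ u (λ x p → proj₁ (∧-true p)) Xu (cong₂ (λ a b → a ∧ not b) Xu Yu)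
                  (cong₂ (λ a b → a ∧ not b) Xv Yv) linkᵥ
        inner : Fin m → Bool
        inner e = within X e ∧ crosses es Y e
        total : count (otherEdge W₁) ℕ.+ count (otherEdge W₂) ≤ 3
        total = begin
          count (otherEdge W₁) ℕ.+ count (otherEdge W₂)
            ≡⟨ count-distrib-+ (otherEdge W₁) (otherEdge W₂) ⟩
          ℕΣ.sum (λ e → bit (otherEdge W₁ e) ℕ.+ bit (otherEdge W₂ e))
            ≡⟨ ℕΣ.sum-cong-≗ (λ e → toOther-split (X (tl es e)) (X (hd es e)) (Y (tl es e)) (Y (hd es e)) _ _
                 (avoids (s∉X g) (tl es e)) (avoids (s∉X g) (hd es e))) ⟩
          ℕΣ.sum (λ e → bit (otherEdge X e) ℕ.+ (bit (inner e) ℕ.+ bit (inner e)))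
            ≡⟨ ℕΣ.∑-distrib-+ (bit ∘ otherEdge X) _ ⟩
          count (otherEdge X) ℕ.+ ℕΣ.sum (λ e → bit (inner e) ℕ.+ bit (inner e))
            ≡⟨ cong (count (otherEdge X) ℕ.+_) (ℕΣ.∑-distrib-+ (bit ∘ inner) _) ⟩
          count (otherEdge X) ℕ.+ (count inner ℕ.+ count inner)
            ≤⟨ ℕ.+-mono-≤ (other g) (ℕ.+-mono-≤ few few) ⟩
          3 ∎
          where open ℕ.≤-Reasoning

-- Graphs without small cuts

two-elements : (c : Fin n → Bool) → 2 ≤ count c → ∃ λ a → ∃ λ b → a ≢ b × c a ≡ true × c b ≡ true
two-elements c 2≤ with count c in eq
two-elements c (s≤s (s≤s z≤n)) | suc (suc k) with count-pop c eq
... | a , ca , eq′ with count-pop (c [ a ]≔ false) eq′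
... | b , cb , _ = a , b , a≢b , ca , trans (sym (≔-≢ c (a≢b ∘ sym))) cb
  where
  a≢b : a ≢ b
  a≢b refl = true≢false cb (≔-eq c a)

-- What one growth step absorbs into the root. The walks `J` use only edges on which `C` is odd, so
-- corrections along them may ruin the other two labellings there; `C` itself lives inside `Y`, away
-- from `s`.
record Ear (es : Ends n m) (s : Fin n) : Set where
  field
    Y     : Fin n → Bool
    s∉Y   : Y s ≡ false
    u v   : Fin n
    u∈Y   : Y u ≡ true
    v∈Y   : Y v ≡ true
    a b   : Fin m
    a≢b   : a ≢ b
    a-us  : Link es a u s
    b-vs  : Link es b v s
    C     : Fin m → ℤ
    ∂C    : ∀ x → 2ℤ ∣ ∂ -1ℤ es C x
    C⊆    : ∀ e → C e ≢ 0ℤ → Y (tl es e) ≡ true × Y (hd es e) ≡ true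
    J     : Fin n → Fin m → ℤ
    ∂J    : ∀ y → Y y ≡ true → ∀ x → ∂ -1ℤ es (J y) x ≡ δ x y - δ x u
    J⊆    : ∀ y → Y y ≡ true → ∀ e → J y e ≢ 0ℤ → Odd (C e) × Y (tl es e) ≡ true × Y (hd es e) ≡ true

-- The flow form of two edge-disjoint paths. With values 0, 1 and -1, odd means nonzero, and the
-- excess is even also at the source and the sink, so the support is an even subgraph. The vertices
-- `u` and `v` may coincide.
two-flow : (es : Ends n m) (U : Fin m → Bool) (u v : Fin n) →
  (∀ Y → Y u ≡ true → Y v ≡ false → 2 ≤ count (λ e → U e ∧ crosses es Y e)) →
  ∃ λ φ → Unitary es U φ × (∀ x → ∂ -1ℤ es φ x ≡ 2ℤ * (δ x v - δ x u))
two-flow es U u v sep =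
  let φ₁ , U₁ , ∂₁ = augment es U u v 0 (const 0ℤ) (record { unit = λ _ → inj₁ refl ; off = λ _ _ → refl })
        (λ x → trans (∂-0 -1ℤ es x) (sym (ℤ.*-zeroˡ (δ x v - δ x u))))
        (λ Y Yu Yv eq → case subst (2 ≤_) eq (sep Y Yu Yv) of λ ())
  in augment es U u v 1 φ₁ U₁ ∂₁ (λ Y Yu Yv eq → case subst (2 ≤_) eq (sep Y Yu Yv) of λ { (s≤s ()) })

module _ (es : Ends n m) (s : Fin n) {X : Fin n → Bool} (s∉X : X s ≡ false)
  {u v : Fin n} (u∈X : X u ≡ true) {a b : Fin m} (a≢b : a ≢ b) (a-us : Link es a u s) (b-vs : Link es b v s)
  {φ : Fin m → ℤ} (Uφ : Unitary es (Rooted.within es s X) φ)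
  (∂φ : ∀ x → ∂ -1ℤ es φ x ≡ 2ℤ * (δ x v - δ x u)) where

  private
    φ⊆X : ∀ e → φ e ≢ 0ℤ → X (tl es e) ≡ true × X (hd es e) ≡ true
    φ⊆X e φ≢0 with Rooted.within es s X e in Ue
    ... | true  = ∧-true Ue
    ... | false = contradiction (off Uφ e Ue) φ≢0

  component-ear : Component es X φ u → Ear es s
  component-ear K = record
    { Y = Y ; s∉Y = s∉Y ; u = u ; v = v ; u∈Y = u∈Y ; v∈Y = component-∋ es K v ∂φ
    ; a = a ; b = b ; a≢b = a≢b ; a-us = a-us ; b-vs = b-vs
    ; C = part es K ; ∂C = evenC ; C⊆ = C⊆ ; J = J ; ∂J = ∂J
    ; J⊆ = λ y Yy e ne → let p , q , r = J⊆ y Yy e ne in oddC e p q , q , r }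
    where
    open Component K
    s∉Y : Y s ≡ false
    s∉Y with Y s in eq
    ... | false = refl
    ... | true  = ⊥-elim (true≢false (Y⊆X s eq) s∉X)
    evenC : ∀ x → 2ℤ ∣ ∂ -1ℤ es (part es K) x
    evenC x = subst (2ℤ ∣_) (sym (trans (∂-part es K x) (cong (χ (Y x) *_) (∂φ x))))
      (∣n⇒∣m*n (χ (Y x)) (divides (δ x v - δ x u) (ℤ.*-comm 2ℤ (δ x v - δ x u))))
    C⊆ : ∀ e → part es K e ≢ 0ℤ → Y (tl es e) ≡ true × Y (hd es e) ≡ true
    C⊆ e C≢0 with φ e ℤ.≟ 0ℤ
    ... | yes φ≡0 = contradiction (trans (cong (χ (Y (tl es e)) *_) φ≡0) (ℤ.*-zeroʳ (χ (Y (tl es e))))) C≢0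
    ... | no φ≢0 with Y (tl es e) in Yt
    ...   | true  = refl , trans (sym (closed e φ≢0)) Yt
    ...   | false = contradiction refl C≢0
    oddC : ∀ e → φ e ≢ 0ℤ → Y (tl es e) ≡ true → Odd (part es K e)
    oddC e φ≢0 Yt rewrite Yt | ℤ.*-identityˡ (φ e) = unit-odd (unit Uφ e) φ≢0

  flow-ear : Ear es s
  flow-ear = component-ear (component es X φ u u∈X φ⊆X)

-- A minimal set X ∌ s with two edges to s and at most one edge elsewhere cannot be
-- split by a single edge, so by Menger the ends of the two edges carry a 2-flow in X.
ear : (es : Ends n m) (s : Fin n) → NoSmallCut es → ∀ e x → x ≢ s → Link es e x s → Ear es s
ear es s noSmall e x x≢s link =
  let open Rooted es s
      X , good , minimal = minimal-good (not ∘ isRoot) (complement-good noSmall e x x≢s link)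
      a , b , a≢b , ra , rb = two-elements (rootEdge X) (Good.root good)
      u , u∈X , a-us = link-rootEdge {X} {a} ra
      v , v∈X , b-vs = link-rootEdge {X} {b} rb
      φ , Uφ , ∂φ = two-flow es (within X) u v (separation noSmall good minimal u∈X v∈X a-us b-vs)
  in flow-ear es s {X} (Good.s∉X good) u∈X a≢b a-us b-vs Uφ ∂φ

-- Lifting flows through the contraction of an ear

abstract
  onLoops : Ends n m → ℤ → (Fin m → ℤ) → Fin m → ℤ
  onLoops es c f e = if does (tl es e Fin.≟ hd es e) then c else f e

  onLoops-loop : (es : Ends n m) {c : ℤ} (f : Fin m → ℤ) {e : Fin m} → tl es e ≡ hd es e → onLoops es c f e ≡ c
  onLoops-loop es f {e} loop rewrite dec-true (tl es e Fin.≟ hd es e) loop = refl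

  onLoops-≢ : (es : Ends n m) {c : ℤ} (f : Fin m → ℤ) {e : Fin m} → tl es e ≢ hd es e → onLoops es c f e ≡ f e
  onLoops-≢ es f {e} ¬loop rewrite dec-false (tl es e Fin.≟ hd es e) ¬loop = refl

∂-loop : (es : Ends n m) (z : ℤ) {e : Fin m} → tl es e ≡ hd es e → ∀ x → z * (δ x (hd es e) + -1ℤ * δ x (tl es e)) ≡ 0ℤ
∂-loop es z {e} loop x = trans (cong (λ y → z * (δ x (hd es e) + -1ℤ * δ x y)) loop) (ring z (δ x (hd es e)))
  where
  ring : ∀ z d → z * (d + -1ℤ * d) ≡ 0ℤ
  ring = solve-∀

∂-onLoops : (es : Ends n m) (c : ℤ) (f : Fin m → ℤ) → ∀ x → ∂ -1ℤ es (onLoops es c f) x ≡ ∂ -1ℤ es f x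
∂-onLoops es c f x = sum-cong-≗ term
  where
  term : ∀ e → onLoops es c f e * (δ x (hd es e) + -1ℤ * δ x (tl es e)) ≡ f e * (δ x (hd es e) + -1ℤ * δ x (tl es e))
  term e = case tl es e Fin.≟ hd es e of λ where
    (yes loop) → trans (∂-loop es (onLoops es c f e) loop x) (sym (∂-loop es (f e) loop x))
    (no ¬loop) → cong (_* (δ x (hd es e) + -1ℤ * δ x (tl es e))) (onLoops-≢ es f ¬loop)

even+odd : ∀ {x y} → ¬ Odd x → Odd y → Odd (x + y)
even+odd {x} ¬odd-x odd-y 2∣x+y = odd-y (∣m+n∣m⇒∣n 2∣x+y (decidable-stable (2ℤ ∣? x) ¬odd-x))

collapse-in : (Y : Fin n → Bool) (s : Fin n) {x : Fin n} → Y x ≡ true → collapse Y s x ≡ s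
collapse-in Y s Yx rewrite Yx = refl

collapse-root : (Y : Fin n → Bool) (s : Fin n) → collapse Y s s ≡ s
collapse-root Y s with Y s
... | true  = refl
... | false = refl

collapse-out : (Y : Fin n → Bool) (s : Fin n) {x : Fin n} → Y x ≡ false → collapse Y s x ≡ x
collapse-out Y s Yx rewrite Yx = refl

-- `C-off` keeps the third labelling away from the root, so that it survives expanding the root back
-- into several vertices without correction. Loops are exempt because they are reset at each step.
record Flows (es : Ends n m) (s : Fin n) : Set where
  field
    f g C : Fin m → ℤ
    ∂f    : ∀ x → ∂ -1ℤ es f x ≡ 0ℤ
    ∂g    : ∀ x → ∂ -1ℤ es g x ≡ 0ℤ
    ∂C    : ∀ x → 2ℤ ∣ ∂ -1ℤ es C x
    C-off : ∀ e → tl es e ≢ hd es e → tl es e ≡ s ⊎ hd es e ≡ s → C e ≡ 0ℤ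
    cover : ∀ e → tl es e ≢ hd es e → Odd (f e) ⊎ Odd (g e) ⊎ Odd (C e)

-- A vertex that collapses to `s` meets only edges on which `C` is zero; at every other vertex
-- contraction does not change which edges arrive.
∂-uncontract : (es : Ends n m) (Y : Fin n → Bool) (s : Fin n) (C : Fin m → ℤ) →
  (∀ e → collapse Y s (tl es e) ≡ s ⊎ collapse Y s (hd es e) ≡ s → C e ≡ 0ℤ) →
  (∀ x → 2ℤ ∣ ∂ -1ℤ (contract Y s es) C x) → ∀ x → 2ℤ ∣ ∂ -1ℤ es C x
∂-uncontract {n} {m} es Y s C C-off even x = case collapse Y s x Fin.≟ s of λ where
    (yes inside) → subst (2ℤ ∣_) (sym (sum-0 _ (zero-term inside))) 2∣0
    (no outside) → subst (2ℤ ∣_) (sum-cong-≗ (same-term outside)) (even x)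
  where
  dipole : ∀ e → Fin n → ℤ
  dipole e x = δ x (hd es e) + -1ℤ * δ x (tl es e)
  zero-term : collapse Y s x ≡ s → ∀ e → C e * dipole e x ≡ 0ℤ
  zero-term inside e = case C e ℤ.≟ 0ℤ of λ where
    (yes C≡0) → cong (_* dipole e x) C≡0
    (no C≢0) → trans (cong₂ (λ p q → C e * (p + -1ℤ * q))
        (δ-≢ λ { refl → C≢0 (C-off e (inj₂ inside)) }) (δ-≢ λ { refl → C≢0 (C-off e (inj₁ inside)) }))
      (ℤ.*-zeroʳ (C e))
  same-δ : collapse Y s x ≢ s → ∀ y → δ x (collapse Y s y) ≡ δ x y
  same-δ outside y = by-cases (Y y) refl
    where
    by-cases : ∀ b → Y y ≡ b → δ x (collapse Y s y) ≡ δ x y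
    by-cases false Yy = cong (δ x) (collapse-out Y s Yy)
    by-cases true  Yy = trans (cong (δ x) (collapse-in Y s Yy)) (trans
      (δ-≢ λ { refl → outside (collapse-root Y s) }) (sym (δ-≢ λ { refl → outside (collapse-in Y s Yy) })))
  same-term : collapse Y s x ≢ s → ∀ e →
    C e * (δ x (collapse Y s (hd es e)) + -1ℤ * δ x (collapse Y s (tl es e))) ≡ C e * dipole e x
  same-term outside e = cong₂ (λ p q → C e * (p + -1ℤ * q)) (same-δ outside (hd es e)) (same-δ outside (tl es e))

module _ (es : Ends n m) (s : Fin n) (E : Ear es s) (F : Flows (contract (Ear.Y E) s es) s) where
  open Ear E
  open Flows F using (f; g) renaming (C to C₁)
  private
    G : Ends n m
    G = contract Y s es
    bump-a = ∂-bump-link es (link-sym es {a} a-us)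
    σ = proj₁ bump-a
    bump-b = ∂-bump-link es (link-sym es {b} b-vs)
    τ = proj₁ bump-b

    -- Starting the walks at `s` by way of `a` means that lifting disturbs only `a` and edges on
    -- which `C` is odd; in particular it leaves `b` alone.
    J′ : Fin n → Fin m → ℤ
    J′ y = bump (J y) a σ

    ∂J′ : ∀ y → Y y ≡ true → ∀ x → ∂ -1ℤ es (J′ y) x ≡ δ x y - δ x s
    ∂J′ y Yy x = trans (proj₂ (proj₂ bump-a) (J y) x)
      (trans (cong (_+ (δ x u - δ x s)) (∂J y Yy x)) (ring (δ x y) (δ x u) (δ x s)))
      where
      ring : ∀ a b c → (a - b) + (b - c) ≡ a - c
      ring = solve-∀

    root-J : ∀ {e w} → Link es e w s → ∀ y → Y y ≡ true → J y e ≡ 0ℤ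
    root-J {e} link y Yy = decidable-stable (J y e ℤ.≟ 0ℤ) λ ne →
      let _ , t , h = J⊆ y Yy e ne in case link of λ where
        (inj₁ eq) → true≢false (subst (λ p → Y (proj₂ p) ≡ true) eq h) s∉Y
        (inj₂ eq) → true≢false (subst (λ p → Y (proj₁ p) ≡ true) eq t) s∉Y

    -- A closed walk from `s` through `b` to `v` and back along `J v` and `a`. It is odd at `a`, and
    -- the other edges it can affect, apart from `b`, are covered by `C`.
    D : Fin m → ℤ
    D = bump (λ e → -1ℤ * J′ v e) b τ

    ∂D : ∀ x → ∂ -1ℤ es D x ≡ 0ℤ
    ∂D x = trans (proj₂ (proj₂ bump-b) (λ e → -1ℤ * J′ v e) x)
      (trans (cong (_+ (δ x v - δ x s)) (trans (∂-* -1ℤ es -1ℤ (J′ v) x) (cong (-1ℤ *_) (∂J′ v v∈Y x))))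
        (ring (δ x v) (δ x s)))
      where
      ring : ∀ a b → -1ℤ * (a - b) + (a - b) ≡ 0ℤ
      ring = solve-∀

    D-odd : Odd (D a)
    D-odd = subst Odd (sym value) (negated (proj₁ (proj₂ bump-a)))
      where
      value : D a ≡ -1ℤ * σ
      value = trans (bump-≢ (λ e → -1ℤ * J′ v e) τ a≢b) (cong (-1ℤ *_)
        (trans (bump-eq (J v) a σ) (trans (cong (_+ σ) (root-J {a} a-us v v∈Y)) (ℤ.+-identityˡ σ))))
      negated : ∀ {z} → IsSign z → Odd (-1ℤ * z)
      negated (inj₁ refl) = sign-odd (inj₂ refl)
      negated (inj₂ refl) = sign-odd (inj₁ refl)

    J′-off : ∀ {e} → e ≢ a → (∀ y → Y y ≡ true → J y e ≡ 0ℤ) → ∀ y → Y y ≡ true → J′ y e ≡ 0ℤ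
    J′-off e≢a J≡0 y Yy = trans (bump-≢ (J y) σ e≢a) (J≡0 y Yy)

    D-off : ∀ {e} → e ≢ a → e ≢ b → (∀ y → Y y ≡ true → J y e ≡ 0ℤ) → D e ≡ 0ℤ
    D-off e≢a e≢b J≡0 = trans (bump-≢ (λ e → -1ℤ * J′ v e) τ e≢b) (cong (-1ℤ *_) (J′-off e≢a J≡0 v v∈Y))

    -- Loops do not affect the boundary, so those of G are set to 1 before lifting.
    up : (Fin m → ℤ) → Fin m → ℤ
    up h = lift es Y J′ (onLoops G 1ℤ h)

    ∂-up : ∀ {h} → (∀ x → ∂ -1ℤ G h x ≡ 0ℤ) → ∀ x → ∂ -1ℤ es (up h) x ≡ 0ℤ
    ∂-up {h} ∂h x = trans (∂-lift es Y s J′ ∂J′ (onLoops G 1ℤ h) x) (trans (∂-onLoops G 1ℤ h x) (∂h x))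

    up-off : ∀ h {e} → e ≢ a → (∀ y → Y y ≡ true → J y e ≡ 0ℤ) → up h e ≡ onLoops G 1ℤ h e
    up-off h e≢a J≡0 = lift-off es Y J′ (onLoops G 1ℤ h) _ (J′-off e≢a J≡0)

    -- D is added to the second flow only, so b stays covered by the first.
    adjusted : ∃ λ g′ → (∀ x → ∂ -1ℤ es g′ x ≡ 0ℤ) × (∀ e → D e ≡ 0ℤ → g′ e ≡ up g e) × (Odd (up f a) ⊎ Odd (g′ a))
    adjusted with 2ℤ ∣? up f a | 2ℤ ∣? up g a
    ... | no odd | _      = up g , ∂-up (Flows.∂g F) , (λ _ _ → refl) , inj₁ odd
    ... | yes _  | no odd = up g , ∂-up (Flows.∂g F) , (λ _ _ → refl) , inj₂ odd
    ... | yes _  | yes 2∣g =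
        (λ e → up g e + D e)
      , (λ x → trans (∂-+ -1ℤ es (up g) D x) (cong₂ _+_ (∂-up (Flows.∂g F) x) (∂D x)))
      , (λ e D≡0 → trans (cong (up g e +_) D≡0) (ℤ.+-identityʳ _))
      , inj₂ (even+odd (λ odd → odd 2∣g) D-odd)

    g′ = proj₁ adjusted

    -- Loops get 0 here, not 1 as in the flows: this keeps the parity of the ear's `C` on edges
    -- inside `Y` when the two are added, and makes `C₂` vanish on every edge at the root, loops
    -- included.
    C₂ : Fin m → ℤ
    C₂ = onLoops G 0ℤ C₁

    C₂-off : ∀ e → tl G e ≡ s ⊎ hd G e ≡ s → C₂ e ≡ 0ℤ
    C₂-off e touch = case tl G e Fin.≟ hd G e of λ where
      (yes loop) → onLoops-loop G C₁ loop
      (no ¬loop) → trans (onLoops-≢ G C₁ ¬loop) (Flows.C-off F e ¬loop touch)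

    inside-loop : ∀ {e} → Y (tl es e) ≡ true → Y (hd es e) ≡ true → tl G e ≡ hd G e
    inside-loop Yt Yh = trans (collapse-in Y s Yt) (sym (collapse-in Y s Yh))

    root-loop : ∀ {e w} → Y w ≡ true → Link es e w s → tl G e ≡ hd G e
    root-loop Yw (inj₁ eq) = subst (λ p → collapse Y s (proj₁ p) ≡ collapse Y s (proj₂ p)) (sym eq)
      (trans (collapse-in Y s Yw) (sym (collapse-root Y s)))
    root-loop Yw (inj₂ eq) = subst (λ p → collapse Y s (proj₁ p) ≡ collapse Y s (proj₂ p)) (sym eq)
      (trans (collapse-root Y s) (sym (collapse-in Y s Yw)))

    Covered : Fin m → Set
    Covered e = Odd (up f e) ⊎ Odd (g′ e) ⊎ Odd (C₂ e + C e)

    covered-loop : ∀ e → e ≢ a → tl G e ≡ hd G e → Dec (2ℤ ∣ C e) → Covered e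
    covered-loop e e≢a loop (no odd) = inj₂ (inj₂ (subst Odd
      (sym (trans (cong (_+ C e) (onLoops-loop G C₁ loop)) (ℤ.+-identityˡ _))) odd))
    -- No walk `J y` uses an edge on which `C` is even, so the value 1 given to the loop survives
    -- lifting.
    covered-loop e e≢a loop (yes even) =
      inj₁ (subst Odd (sym (trans (up-off f e≢a J≡0) (onLoops-loop G f loop))) 2∤1)
      where
      J≡0 : ∀ y → Y y ≡ true → J y e ≡ 0ℤ
      J≡0 y Yy = decidable-stable (J y e ℤ.≟ 0ℤ) λ ne → proj₁ (J⊆ y Yy e ne) even

    covered-nonLoop : ∀ e → e ≢ a → e ≢ b → tl G e ≢ hd G e → Odd (f e) ⊎ Odd (g e) ⊎ Odd (C₁ e) → Covered e
    covered-nonLoop e e≢a e≢b ¬loop = λ where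
        (inj₁ p)        → inj₁ (subst Odd (sym (up≡ f)) p)
        (inj₂ (inj₁ p)) → inj₂ (inj₁ (subst Odd
          (sym (trans (proj₁ (proj₂ (proj₂ adjusted)) e (D-off e≢a e≢b J≡0)) (up≡ g))) p))
        (inj₂ (inj₂ p)) → inj₂ (inj₂ (subst Odd
          (sym (trans (cong₂ _+_ (onLoops-≢ G C₁ ¬loop) C≡0) (ℤ.+-identityʳ _))) p))
      where
      J≡0 : ∀ y → Y y ≡ true → J y e ≡ 0ℤ
      J≡0 y Yy = decidable-stable (J y e ℤ.≟ 0ℤ) λ ne → let _ , t , h = J⊆ y Yy e ne in ¬loop (inside-loop t h)
      C≡0 : C e ≡ 0ℤ
      C≡0 = decidable-stable (C e ℤ.≟ 0ℤ) λ ne → let t , h = C⊆ e ne in ¬loop (inside-loop t h)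
      up≡ : ∀ h → up h e ≡ h e
      up≡ h = trans (up-off h e≢a J≡0) (onLoops-≢ G h ¬loop)

    covered-a : Odd (up f a) ⊎ Odd (g′ a) → Covered a
    covered-a (inj₁ p) = inj₁ p
    covered-a (inj₂ p) = inj₂ (inj₁ p)

    covered-b : b ≢ a → Covered b
    covered-b b≢a = inj₁ (subst Odd
      (sym (trans (up-off f b≢a (root-J {b} b-vs)) (onLoops-loop G f (root-loop {b} v∈Y b-vs)))) 2∤1)

    covered : ∀ e → Dec (e ≡ a) → Dec (e ≡ b) → Dec (tl G e ≡ hd G e) → Covered e
    covered e (yes refl) _          _          = covered-a (proj₂ (proj₂ (proj₂ adjusted)))
    covered e (no e≢a)   (yes refl) _          = covered-b e≢a
    covered e (no e≢a)   (no _)     (yes loop) = covered-loop e e≢a loop (2ℤ ∣? C e)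
    covered e (no e≢a)   (no e≢b)   (no ¬loop) = covered-nonLoop e e≢a e≢b ¬loop (Flows.cover F e ¬loop)

    off-root : ∀ e → tl es e ≢ hd es e → tl es e ≡ s ⊎ hd es e ≡ s → C₂ e + C e ≡ 0ℤ
    off-root e ¬loop touch = cong₂ _+_ (C₂-off e (touchG touch)) (decidable-stable (C e ℤ.≟ 0ℤ) λ ne →
        let t , h = C⊆ e ne in case touch of λ where
          (inj₁ eq) → true≢false (subst (λ z → Y z ≡ true) eq t) s∉Y
          (inj₂ eq) → true≢false (subst (λ z → Y z ≡ true) eq h) s∉Y)
      where
      touchG : tl es e ≡ s ⊎ hd es e ≡ s → tl G e ≡ s ⊎ hd G e ≡ s
      touchG (inj₁ eq) = inj₁ (trans (cong (collapse Y s) eq) (collapse-root Y s))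
      touchG (inj₂ eq) = inj₂ (trans (cong (collapse Y s) eq) (collapse-root Y s))

  expand : Flows es s
  expand = record
    { f = up f ; g = g′ ; C = λ e → C₂ e + C e
    ; ∂f = ∂-up (Flows.∂f F)
    ; ∂g = proj₁ (proj₂ adjusted)
    ; ∂C = λ x → subst (2ℤ ∣_) (sym (∂-+ -1ℤ es C₂ C x)) (∣m∣n⇒∣m+n
        (∂-uncontract es Y s C₂ C₂-off (λ x → subst (2ℤ ∣_) (sym (∂-onLoops G 0ℤ C₁ x)) (Flows.∂C F x)) x) (∂C x))
    ; C-off = off-root
    ; cover = λ e _ → covered e (e Fin.≟ a) (e Fin.≟ b) (tl G e Fin.≟ hd G e) }

nonLoop : Ends n m → Fin m → Bool
nonLoop es e = not (does (tl es e Fin.≟ hd es e))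

nonLoop-true : (es : Ends n m) {e : Fin m} → tl es e ≢ hd es e → nonLoop es e ≡ true
nonLoop-true es ¬loop = cong not (dec-false (_ Fin.≟ _) ¬loop)

contract-fewer : (es : Ends n m) (Y : Fin n → Bool) (s : Fin n) (e : Fin m) → tl es e ≢ hd es e →
  collapse Y s (tl es e) ≡ collapse Y s (hd es e) → count (nonLoop (contract Y s es)) < count (nonLoop es)
contract-fewer es Y s e ¬loop loop = count-mono-< _ _ mono e (cong not (dec-true (_ Fin.≟ _) loop)) (nonLoop-true es ¬loop)
  where
  mono : ∀ e → nonLoop (contract Y s es) e ≡ true → nonLoop es e ≡ true
  mono e p with tl es e Fin.≟ hd es e
  ... | no _     = refl
  ... | yes loop = ⊥-elim (true≢false p (cong not (dec-true (_ Fin.≟ _) (cong (collapse Y s) loop))))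

ear-fewer : (es : Ends n m) (s : Fin n) (E : Ear es s) →
  count (nonLoop (contract (Ear.Y E) s es)) < count (nonLoop es)
ear-fewer es s E = contract-fewer es Y s a ¬loop (loop a-us)
  where
  open Ear E
  u≢s : u ≢ s
  u≢s u≡s = true≢false (subst (λ x → Y x ≡ true) u≡s u∈Y) s∉Y
  ¬loop : tl es a ≢ hd es a
  ¬loop = case a-us of λ where
    (inj₁ eq) → subst (λ p → proj₁ p ≢ proj₂ p) (sym eq) u≢s
    (inj₂ eq) → subst (λ p → proj₁ p ≢ proj₂ p) (sym eq) (u≢s ∘ sym)
  loop : Link es a u s → collapse Y s (tl es a) ≡ collapse Y s (hd es a)
  loop (inj₁ eq) = subst (λ p → collapse Y s (proj₁ p) ≡ collapse Y s (proj₂ p)) (sym eq)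
    (trans (collapse-in Y s u∈Y) (sym (collapse-root Y s)))
  loop (inj₂ eq) = subst (λ p → collapse Y s (proj₁ p) ≡ collapse Y s (proj₂ p)) (sym eq)
    (trans (collapse-root Y s) (sym (collapse-in Y s u∈Y)))

-- Induction on the number of non-loops: `a` becomes a loop at each contraction, and loops remain
-- loops.
flows : (es : Ends n m) → NoSmallCut es → ∀ s → Flows es s
flows {n} {m} es noSmall s = go (suc (count (nonLoop es))) es noSmall s ℕ.≤-refl
  where
  go : ∀ k (es : Ends n m) → NoSmallCut es → ∀ s → count (nonLoop es) < k → Flows es s
  shrink : ∀ k (es : Ends n m) → NoSmallCut es → ∀ s → count (nonLoop es) < suc k → Ear es s → Flows es s
  -- A vertex set of the contraction pulls back along `collapse` to one crossed by the same edges,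
  -- so no small cut can appear.
  shrink k es noSmall s (s≤s le) E = expand es s E
    (go k (contract (Ear.Y E) s es) (λ Z → noSmall (Z ∘ collapse (Ear.Y E) s)) s (ℕ.<-≤-trans (ear-fewer es s E) le))
  at-root : ∀ k (es : Ends n m) → NoSmallCut es → ∀ s → count (nonLoop es) < suc k →
    ∀ e x → x ≢ s → Link es e x s → Flows es s
  at-root k es noSmall s lt e x x≢s link = shrink k es noSmall s lt (ear es s noSmall e x x≢s link)
  go (suc k) es noSmall s lt
    with Fin.any? (λ e → ¬? (tl es e Fin.≟ hd es e) ×-dec ((tl es e Fin.≟ s) ⊎-dec (hd es e Fin.≟ s)))
  ... | yes (e , ¬loop , inj₁ t≡s) = at-root k es noSmall s lt e (hd es e) (λ h≡s → ¬loop (trans t≡s (sym h≡s)))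
          (inj₂ (cong (_, hd es e) t≡s))
  ... | yes (e , ¬loop , inj₂ h≡s) = at-root k es noSmall s lt e (tl es e) (λ t≡s → ¬loop (trans t≡s (sym h≡s)))
          (inj₁ (cong (tl es e ,_) h≡s))
  ... | no isolated with Fin.any? (λ e → ¬? (tl es e Fin.≟ hd es e))
  -- The component of the root is exhausted, so growth restarts at an end of another non-loop. The
  -- result is also valid for the old root, where `C-off` is vacuous.
  ...   | yes (e , ¬loop) = record
    { f = f ; g = g ; C = C ; ∂f = ∂f ; ∂g = ∂g ; ∂C = ∂C
    ; C-off = λ e ¬loop touch → contradiction (e , ¬loop , touch) isolated
    ; cover = cover }
    where open Flows (at-root k es noSmall (hd es e) lt e (tl es e) ¬loop (inj₁ refl))
  ...   | no none = record
    { f = const 0ℤ ; g = const 0ℤ ; C = const 0ℤ ; ∂f = ∂-0 -1ℤ es ; ∂g = ∂-0 -1ℤ es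
    ; ∂C = λ x → subst (2ℤ ∣_) (sym (∂-0 -1ℤ es x)) 2∣0
    ; C-off = λ _ _ _ → refl
    ; cover = λ e ¬loop → contradiction (e , ¬loop) none }

-- Arbitrary graphs

CutEdge : Ends n m → (Fin n → Bool) → Fin m → Set
CutEdge es X e = crosses es X e ≡ true × (∀ e′ → crosses es X e′ ≡ true → e′ ≡ e)

-- The weakening of `Flows` that small cuts allow: with even instead of zero boundaries all three
-- labellings play the same role, and witnessing a cut edge by a vertex set lets it be pulled back
-- through contractions.
record Cover (es : Ends n m) : Set where
  field
    F     : Fin 3 → Fin m → ℤ
    even  : ∀ i x → 2ℤ ∣ ∂ -1ℤ es (F i) x
    cover : ∀ e → tl es e ≢ hd es e → (∃ λ i → Odd (F i e)) ⊎ (∃ λ X → CutEdge es X e)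

crosses-nonLoop : (es : Ends n m) (X : Fin n → Bool) {e : Fin m} → crosses es X e ≡ true → tl es e ≢ hd es e
crosses-nonLoop es X {e} cross loop =
  true≢false cross (trans (cong (λ x → X x xor X (hd es e)) loop) (Bool.xor-same (X (hd es e))))

crosses-value : (es : Ends n m) (X : Fin n → Bool) (e : Fin m) → let d = χ (X (hd es e)) + -1ℤ * χ (X (tl es e)) in
  (crosses es X e ≡ true × IsSign d) ⊎ (crosses es X e ≡ false × d ≡ 0ℤ)
crosses-value es X e with X (tl es e) | X (hd es e)
... | false | false = inj₂ (refl , refl)
... | false | true  = inj₁ (refl , inj₁ refl)
... | true  | false = inj₁ (refl , inj₂ refl)
... | true  | true  = inj₂ (refl , refl)

odd*sign : ∀ {z σ} → IsSign σ → Odd z → Odd (z * σ)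
odd*sign {z} (inj₁ refl) odd 2∣ = odd (subst (2ℤ ∣_) (ℤ.*-identityʳ z) 2∣)
odd*sign {z} (inj₂ refl) odd 2∣ = odd (subst (2ℤ ∣_) (ring z) (∣m⇒∣-m 2∣))
  where
  ring : ∀ z → - (z * -1ℤ) ≡ z
  ring = solve-∀

-- Summing the even boundaries over `X` leaves only the two edges of the cut, each up to sign, so
-- their parities agree.
two-cut-odd : (es : Ends n m) (X : Fin n → Bool) (f : Fin m → ℤ) → (∀ x → 2ℤ ∣ ∂ -1ℤ es f x) →
  ∀ e e′ → e′ ≢ e → crosses es X e′ ≡ true → (∀ d → crosses es X d ≡ true → d ≡ e ⊎ d ≡ e′) →
  Odd (f e′) → Odd (f e)
two-cut-odd {n} {m} es X f even e e′ e′≢e cross two odd 2∣fe =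
  odd*sign sign odd (∣m+n∣m⇒∣n (subst (2ℤ ∣_) total 2∣total) (∣m⇒∣m*n (w e) 2∣fe))
  where
  w : Fin m → ℤ
  w e = χ (X (hd es e)) + -1ℤ * χ (X (tl es e))
  sign : IsSign (w e′)
  sign with crosses-value es X e′
  ... | inj₁ (_ , s) = s
  ... | inj₂ (p , _) = ⊥-elim (true≢false cross p)
  2∣total : 2ℤ ∣ sum (λ x → χ (X x) * ∂ -1ℤ es f x)
  2∣total = even-sum _ λ x → ∣n⇒∣m*n (χ (X x)) (even x)
  fw : Fin m → ℤ
  fw e = f e * w e
  others : ∀ d → d ≢ e′ → (fw [ e ]≔ 0ℤ) d ≡ 0ℤ
  others d d≢e′ = case d Fin.≟ e of λ where
    (yes refl) → ≔-eq fw d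
    (no d≢e) → trans (≔-≢ fw d≢e) (case crosses-value es X d of λ where
      (inj₂ (_ , w≡0)) → trans (cong (f d *_) w≡0) (ℤ.*-zeroʳ (f d))
      (inj₁ (p , _)) → case two d p of λ where
        (inj₁ q) → contradiction q d≢e
        (inj₂ q) → contradiction q d≢e′)
  total : sum (λ x → χ (X x) * ∂ -1ℤ es f x) ≡ f e * w e + f e′ * w e′
  total = trans (pairing -1ℤ es (χ ∘ X) f) (trans (sum-split fw e)
    (cong (fw e +_) (trans (sum-single _ e′ others) (≔-≢ fw e′≢e))))

crosses-xor : (es : Ends n m) (X X′ : Fin n → Bool) (e : Fin m) →
  crosses es (λ x → X x xor X′ x) e ≡ crosses es X e xor crosses es X′ e
crosses-xor es X X′ e = exchange (X (tl es e)) (X (hd es e)) (X′ (tl es e)) (X′ (hd es e))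
  where
  exchange : ∀ a b c d → (a xor c) xor (b xor d) ≡ (a xor b) xor (c xor d)
  exchange = from-yes (all-Bool? λ a → all-Bool? λ b → all-Bool? λ c → all-Bool? λ d →
    (a xor c) xor (b xor d) Bool.≟ (a xor b) xor (c xor d))

-- The symmetric difference of the cuts consisting of `e` and `e′` and of `e′` alone is `e` alone,
-- and cuts add under `xor` of their vertex sets.
two-cut-cutEdge : (es : Ends n m) (X : Fin n → Bool) → ∀ e e′ → e′ ≢ e →
  crosses es X e ≡ true → crosses es X e′ ≡ true → (∀ d → crosses es X d ≡ true → d ≡ e ⊎ d ≡ e′) →
  ∀ X′ → CutEdge es X′ e′ → CutEdge es (λ x → X x xor X′ x) e
two-cut-cutEdge {n} {m} es X e e′ e′≢e cross cross′ two X′ (p′ , unique′) =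
    trans (crosses-xor es X X′ e) (cong₂ _xor_ cross e∉X′)
  , λ d p → only d (trans (sym (crosses-xor es X X′ d)) p)
  where
  e∉X′ : crosses es X′ e ≡ false
  e∉X′ with crosses es X′ e in eq
  ... | false = refl
  ... | true  = contradiction (sym (unique′ e eq)) e′≢e
  only : ∀ d → crosses es X d xor crosses es X′ d ≡ true → d ≡ e
  only d p with crosses es X d in q | crosses es X′ d in q′
  ... | true | false = case two d q of λ where
    (inj₁ d≡e)  → d≡e
    (inj₂ refl) → ⊥-elim (true≢false p′ q′)
  ... | false | true = ⊥-elim (true≢false cross′ (subst (λ d → crosses es X d ≡ false) (unique′ d q′) q))

data SmallCut (es : Ends n m) (X : Fin n → Bool) (e : Fin m) : Set where
  one : (∀ d → crosses es X d ≡ true → d ≡ e) → SmallCut es X e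
  two : ∀ e′ → e′ ≢ e → crosses es X e′ ≡ true → (∀ d → crosses es X d ≡ true → d ≡ e ⊎ d ≡ e′) → SmallCut es X e

≔-false : (c : Fin n → Bool) → ∀ x y → c y ≡ true → y ≡ x ⊎ (c [ x ]≔ false) y ≡ true
≔-false c x y cy with y Fin.≟ x
... | yes y≡x = inj₁ y≡x
... | no y≢x  = inj₂ (trans (≔-≢ c y≢x) cy)

only-element : (c : Fin n → Bool) → count c ≡ 1 → ∃ λ x → c x ≡ true × (∀ y → c y ≡ true → y ≡ x)
only-element c eq with count-pop c eq
... | x , cx , eq′ = x , cx , λ y cy → case ≔-false c x y cy of λ where
  (inj₁ y≡x) → y≡x
  (inj₂ p)   → ⊥-elim (true≢false p (count-zero _ eq′ y))

smallCut : (es : Ends n m) (X : Fin n → Bool) → count (crosses es X) ≡ 1 ⊎ count (crosses es X) ≡ 2 →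
  ∃ λ e → crosses es X e ≡ true × SmallCut es X e
smallCut es X (inj₁ eq) with only-element (crosses es X) eq
... | e , p , unique = e , p , one unique
smallCut es X (inj₂ eq) with count-pop (crosses es X) eq
... | e , p , eq′ with only-element (crosses es X [ e ]≔ false) eq′
... | e′ , p′ , unique = e , p , two e′ e′≢e (trans (sym (≔-≢ (crosses es X) e′≢e)) p′) λ d q →
      case ≔-false (crosses es X) e d q of λ where
        (inj₁ d≡e) → inj₁ d≡e
        (inj₂ r)   → inj₂ (unique d r)
  where
  e′≢e : e′ ≢ e
  e′≢e refl = true≢false p′ (≔-eq (crosses es X) e)

smallCut? : (es : Ends n m) → Dec (∃ λ X → count (crosses es X) ≡ 1 ⊎ count (crosses es X) ≡ 2)
smallCut? {n} es = search-Vector refl search-Bool n _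
  (λ {X} {X′} X≡X′ → subst (λ k → k ≡ 1 ⊎ k ≡ 2)
    (count-cong {c = crosses es X} {crosses es X′} λ e → cong₂ _xor_ (X≡X′ (tl es e)) (X≡X′ (hd es e))))
  (λ X → (count (crosses es X) ℕ.≟ 1) ⊎-dec (count (crosses es X) ℕ.≟ 2))

cover-noSmallCut : (es : Ends n m) → NoSmallCut es → Cover es
cover-noSmallCut es noSmall with Fin.any? (λ e → ¬? (tl es e Fin.≟ hd es e))
... | no none = record
  { F = λ _ _ → 0ℤ ; even = λ i x → subst (2ℤ ∣_) (sym (∂-0 -1ℤ es x)) 2∣0
  ; cover = λ e ¬loop → contradiction (e , ¬loop) none }
... | yes (e , _) = fromFlows (flows es noSmall (tl es e))
  where
  fromFlows : ∀ {s} → Flows es s → Cover es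
  fromFlows Φ = record
    { F = λ { zero → f ; (suc zero) → g ; (suc (suc zero)) → C }
    ; even = λ { zero x → subst (2ℤ ∣_) (sym (∂f x)) 2∣0
               ; (suc zero) x → subst (2ℤ ∣_) (sym (∂g x)) 2∣0
               ; (suc (suc zero)) x → ∂C x }
    ; cover = λ e ¬loop → case cover e ¬loop of λ where
        (inj₁ p)        → inj₁ (zero , p)
        (inj₂ (inj₁ p)) → inj₁ (suc zero , p)
        (inj₂ (inj₂ p)) → inj₁ (suc (suc zero) , p) }
    where open Flows Φ

module _ (es : Ends n m) (e : Fin m) where

  headOf : Fin n → Bool
  headOf = const false [ hd es e ]≔ true

  contractEdge : Ends n m
  contractEdge = contract headOf (tl es e) es

  contractEdge-loop : tl es e ≢ hd es e → tl contractEdge e ≡ hd contractEdge e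
  contractEdge-loop ¬loop = trans (collapse-root headOf (tl es e))
    (sym (collapse-in headOf (tl es e) (≔-eq (const false) (hd es e))))

  module _ (X : Fin n → Bool) (cross : crosses es X e ≡ true) (small : SmallCut es X e) (K : Cover contractEdge) where
    open Cover K

    private
      -- The contracted set has the single vertex `hd es e`, and `e` itself is the walk leading to
      -- it; hence lifting changes the label of `e` only.
      J : Fin n → Fin m → ℤ
      J _ e′ = δ e′ e

      F′ : Fin 3 → Fin m → ℤ
      F′ i = lift es headOf J (onLoops contractEdge 1ℤ (F i))

      ∂J : ∀ y → headOf y ≡ true → ∀ x → ∂ -1ℤ es (J y) x ≡ δ x y - δ x (tl es e)
      ∂J y p x = case ≔-true (const false) (hd es e) {y} p of λ where
        (inj₁ refl) → trans (∂-δ -1ℤ es e x) (cong (δ x (hd es e) +_) (ℤ.-1*i≡-i _))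

      even′ : ∀ i x → 2ℤ ∣ ∂ -1ℤ es (F′ i) x
      even′ i x = subst (2ℤ ∣_) (sym (trans (∂-lift es headOf (tl es e) J ∂J (onLoops contractEdge 1ℤ (F i)) x) (∂-onLoops contractEdge 1ℤ (F i) x)))
        (even i x)

      F′-off : ∀ i {d} → d ≢ e → F′ i d ≡ onLoops contractEdge 1ℤ (F i) d
      F′-off i d≢e = lift-off es headOf J (onLoops contractEdge 1ℤ (F i)) _ λ _ _ → δ-≢ d≢e

      Covered : Fin m → Set
      Covered d = (∃ λ i → Odd (F′ i d)) ⊎ (∃ λ X → CutEdge es X d)

      covered-≢ : ∀ d → d ≢ e → Covered d
      covered-≢ d d≢e = case tl contractEdge d Fin.≟ hd contractEdge d of λ where
        (yes loop) → inj₁ (zero , subst Odd (sym (trans (F′-off zero d≢e) (onLoops-loop contractEdge (F zero) loop))) 2∤1)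
        (no ¬loop) → case cover d ¬loop of λ where
          (inj₁ (i , odd)) → inj₁ (i , subst Odd (sym (trans (F′-off i d≢e) (onLoops-≢ contractEdge (F i) ¬loop))) odd)
          (inj₂ (Z , cut)) → inj₂ (Z ∘ collapse headOf (tl es e) , cut)

      -- The label that lifting leaves on `e` cannot be prescribed, but its parity is dictated by
      -- the cut: `e` takes over the status of the other edge, if there is one.
      covered-e : SmallCut es X e → Covered e
      covered-e (one unique) = inj₂ (X , cross , unique)
      covered-e (two e′ e′≢e cross′ both) = case covered-≢ e′ e′≢e of λ where
        (inj₁ (i , odd)) → inj₁ (i , two-cut-odd es X (F′ i) (even′ i) e e′ e′≢e cross′ both odd)
        (inj₂ (Z , cut)) → inj₂ ((λ x → X x xor Z x) , two-cut-cutEdge es X e e′ e′≢e cross cross′ both Z cut)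

      covered : ∀ d → Dec (d ≡ e) → Covered d
      covered d (yes refl) = covered-e small
      covered d (no d≢e)   = covered-≢ d d≢e

    uncontractEdge : Cover es
    uncontractEdge = record { F = F′ ; even = even′ ; cover = λ d _ → covered d (d Fin.≟ e) }

coverOf : (es : Ends n m) → Cover es
coverOf {n} {m} es = go (suc (count (nonLoop es))) es ℕ.≤-refl
  where
  go : ∀ k (es : Ends n m) → count (nonLoop es) < k → Cover es
  go (suc k) es (s≤s le) = case smallCut? es of λ where
    (no none) → cover-noSmallCut es λ X → (λ eq → none (X , inj₁ eq)) , (λ eq → none (X , inj₂ eq))
    (yes (X , eq)) → let e , cross , small = smallCut es X eq
                         ¬loop = crosses-nonLoop es X cross in
      uncontractEdge es e X cross small (go k (contractEdge es e) (ℕ.<-≤-trans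
        (contract-fewer es (headOf es e) (tl es e) e ¬loop (contractEdge-loop es e ¬loop)) le))

-- Cut edges of regular graphs

∂⁺-bump-link : (es : Ends n m) (φ : Fin m → ℤ) {d : Fin m} {x y : Fin n} → Link es d x y → ∀ τ z →
  ∂ 1ℤ es (bump φ d τ) z ≡ ∂ 1ℤ es φ z + τ * (δ z x + δ z y)
∂⁺-bump-link es φ {d} {x} {y} link τ z = trans (∂-bump 1ℤ es φ d τ z) (cong (λ a → ∂ 1ℤ es φ z + τ * a) (case link of λ where
  (inj₁ eq) → trans (cong (λ p → δ z (proj₂ p) + 1ℤ * δ z (proj₁ p)) eq) (ring₁ (δ z y) (δ z x))
  (inj₂ eq) → trans (cong (λ p → δ z (proj₂ p) + 1ℤ * δ z (proj₁ p)) eq) (ring₂ (δ z x) (δ z y))))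
  where
  ring₁ : ∀ a b → a + 1ℤ * b ≡ b + a
  ring₁ = solve-∀
  ring₂ : ∀ a b → a + 1ℤ * b ≡ a + b
  ring₂ = solve-∀

sign-neg : ∀ {z} → IsSign z → IsSign (- z)
sign-neg (inj₁ refl) = inj₂ refl
sign-neg (inj₂ refl) = inj₁ refl

signs-cancel : ∀ {y z} → IsSign y → IsSign z → y ≢ z → y + z ≡ 0ℤ
signs-cancel (inj₁ refl) (inj₁ refl) ne = contradiction refl ne
signs-cancel (inj₁ refl) (inj₂ refl) ne = refl
signs-cancel (inj₂ refl) (inj₁ refl) ne = refl
signs-cancel (inj₂ refl) (inj₂ refl) ne = contradiction refl ne

-- One side X of a cut edge e with end u ∈ X: labels alternating along walks from u give
-- a labelling with boundary 2u, unless the side is bipartite.  Counting its edges by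
-- colour classes, a bipartite side would make r divide 1.
module _ (es : Ends n m) (r : ℕ) (2≤r : 2 ≤ r) (regular : ∀ x → ∂ 1ℤ es (const 1ℤ) x ≡ ℤ.+ r) (e : Fin m) where

  -- `L y` alternates 1 and -1 along a walk from `u` to `y` that avoids `e`; `σ y` is -1 for walks
  -- of even length and 1 for odd length, so it is the colour of `y` if the side is bipartite.
  record Coloured (X : Fin n → Bool) (u : Fin n) : Set where
    field
      Y      : Fin n → Bool
      u∈Y    : Y u ≡ true
      Y⊆X    : ∀ y → Y y ≡ true → X y ≡ true
      closed : ∀ d → d ≢ e → Y (tl es d) ≡ Y (hd es d)
      σ      : Fin n → ℤ
      sign   : ∀ y → Y y ≡ true → IsSign (σ y)
      L      : Fin n → Fin m → ℤ
      ∂L     : ∀ y → Y y ≡ true → ∀ x → ∂ 1ℤ es (L y) x ≡ δ x u + σ y * δ x y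
      L-off  : ∀ y → Y y ≡ true → L y e ≡ 0ℤ

  colour : (X : Fin n → Bool) (u : Fin n) → X u ≡ true →
    (∀ d → d ≢ e → X (tl es d) ≡ X (hd es d)) → Coloured X u
  colour X u Xu X-closed = conclude (grow Step step? Inv extend Y₀ inv₀)
    where
    Step : Fin n → Fin n → Set
    Step x y = ∃ λ d → d ≢ e × Link es d x y
    step? : Decidable Step
    step? x y = Fin.any? λ d → ¬? (d Fin.≟ e) ×-dec link? es d x y
    Ok : ℤ → (Fin m → ℤ) → Fin n → Set
    Ok τ ℓ y = X y ≡ true × IsSign τ × (∀ x → ∂ 1ℤ es ℓ x ≡ δ x u + τ * δ x y) × ℓ e ≡ 0ℤ
    Inv : (Fin n → Bool) → Set
    Inv Y = ∃ λ (σ : Fin n → ℤ) → ∃ λ (L : Fin n → Fin m → ℤ) → ∀ y → Y y ≡ true → Ok (σ y) (L y) y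
    Y₀ : Fin n → Bool
    Y₀ = const false [ u ]≔ true
    inv₀ : Inv Y₀
    inv₀ = const -1ℤ , (λ _ _ → 0ℤ) , λ y Yy → case ≔-true (const false) u {y} Yy of λ where
        (inj₁ refl) → Xu , inj₂ refl , (λ x → trans (∂-0 1ℤ es x) (ring (δ x y))) , refl
      where
      ring : ∀ a → 0ℤ ≡ a + -1ℤ * a
      ring = solve-∀
    extend : ∀ Y x y → Inv Y → Y x ≡ true → Y y ≡ false → Step x y → Inv (Y [ y ]≔ true)
    extend Y x y (σ , L , ok) Yx Yy (d , d≢e , link) = σ′ , L′ , ok′
      where
      τ = - σ x
      ℓ = bump (L x) d τ
      σ′ = σ [ y ]≔ τ
      L′ = L [ y ]≔ ℓ
      ring : ∀ a s b c → (a + s * b) + (- s) * (b + c) ≡ a + (- s) * c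
      ring = solve-∀
      Xy : X y ≡ true
      Xy = case link of λ where
        (inj₁ eq) → trans (sym (subst (λ p → X (proj₁ p) ≡ X (proj₂ p)) eq (X-closed d d≢e))) (proj₁ (ok x Yx))
        (inj₂ eq) → trans (subst (λ p → X (proj₁ p) ≡ X (proj₂ p)) eq (X-closed d d≢e)) (proj₁ (ok x Yx))
      new : Ok τ ℓ y
      new = let _ , s , ∂ℓ , off = ok x Yx in
        Xy , sign-neg s
        , (λ z → trans (∂⁺-bump-link es (L x) link τ z) (trans (cong (_+ τ * (δ z x + δ z y)) (∂ℓ z))
            (ring (δ z u) (σ x) (δ z x) (δ z y))))
        , trans (bump-≢ (L x) τ (d≢e ∘ sym)) off
      ok′ : ∀ z → (Y [ y ]≔ true) z ≡ true → Ok (σ′ z) (L′ z) z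
      ok′ z Y′z = case z Fin.≟ y of λ where
        (yes refl) → subst₂ (λ s l → Ok s l z) (sym (≔-eq σ z)) (sym (≔-eq L z)) new
        (no z≢y)   → subst₂ (λ s l → Ok s l z) (sym (≔-≢ σ z≢y)) (sym (≔-≢ L z≢y)) (ok z (trans (sym (≔-≢ Y z≢y)) Y′z))
    conclude : (∃ λ Z → Inv Z × (∀ x → Y₀ x ≡ true → Z x ≡ true) ×
      (∀ x y → Step x y → Z x ≡ true → Z y ≡ true)) → Coloured X u
    conclude (Z , (σ , L , ok) , sub , clo) = record
      { Y = Z ; u∈Y = sub u (≔-eq (const false) u) ; Y⊆X = λ y Zy → proj₁ (ok y Zy)
      ; closed = closed ; σ = σ ; sign = λ y Zy → proj₁ (proj₂ (ok y Zy))
      ; L = L ; ∂L = λ y Zy → proj₁ (proj₂ (proj₂ (ok y Zy))) ; L-off = λ y Zy → proj₂ (proj₂ (proj₂ (ok y Zy))) }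
      where
      closed : ∀ d → d ≢ e → Z (tl es d) ≡ Z (hd es d)
      closed d d≢e with Z (tl es d) in Zt | Z (hd es d) in Zh
      ... | true  | true  = refl
      ... | false | false = refl
      ... | true  | false = ⊥-elim (true≢false (clo _ _ (d , d≢e , inj₁ refl) Zt) Zh)
      ... | false | true  = ⊥-elim (true≢false (clo _ _ (d , d≢e , inj₂ refl) Zh) Zt)

  r∤sign : ∀ W {τ} → IsSign τ → W * ℤ.+ r ≢ τ
  r∤sign W s eq = ℕ.<-irrefl (sym r≡1) 2≤r
    where
    abs-sign : ∀ {τ} → IsSign τ → ℤ.∣ τ ∣ ≡ 1
    abs-sign (inj₁ refl) = refl
    abs-sign (inj₂ refl) = refl
    r≡1 : r ≡ 1
    r≡1 = ℕ.m*n≡1⇒n≡1 ℤ.∣ W ∣ r (trans (sym (ℤ.abs-* W (ℤ.+ r))) (trans (cong ℤ.∣_∣ eq) (abs-sign s)))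

  dead-end : (X : Fin n → Bool) {u w : Fin n} → X w ≡ false → Link es e u w → Coloured X u →
    ∃ λ ℓ → (∀ x → ∂ 1ℤ es ℓ x ≡ 2ℤ * δ x u) × ℓ e ≡ 0ℤ
  dead-end X {u} {w} Xw link K = result (Fin.any? λ d → ¬? (d Fin.≟ e) ×-dec
      ((Y (tl es d) Bool.≟ true) ×-dec ((Y (hd es d) Bool.≟ true) ×-dec (σ (tl es d) ℤ.≟ σ (hd es d)))))
    where
    open Coloured K
    Conflict : Fin m → Set
    Conflict d = d ≢ e × Y (tl es d) ≡ true × Y (hd es d) ≡ true × σ (tl es d) ≡ σ (hd es d)
    result : Dec (∃ Conflict) → ∃ λ ℓ → (∀ x → ∂ 1ℤ es ℓ x ≡ 2ℤ * δ x u) × ℓ e ≡ 0ℤ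
    -- The edge `d` joins two ends of equal colour: the walk to its tail, then `d`, then the walk to
    -- its head traversed back is an odd closed walk, and the two contributions at `u` add up
    -- instead of cancelling.
    result (yes (d , d≢e , Yt , Yh , same)) = (λ d → ℓ₁ d + L h d)
        , (λ x → trans (∂-+ 1ℤ es ℓ₁ (L h) x) (trans (cong₂ _+_
            (trans (∂⁺-bump-link es (L t) {d} {t} {h} (inj₁ refl) (- σ t) x)
              (cong (_+ (- σ t) * (δ x t + δ x h)) (∂L t Yt x)))
            (trans (∂L h Yh x) (cong (λ s → δ x u + s * δ x h) (sym same))))
            (ring (δ x u) (σ t) (δ x t) (δ x h))))
        , cong₂ _+_ (trans (bump-≢ (L t) (- σ t) (d≢e ∘ sym)) (L-off t Yt)) (L-off h Yh)
      where
      t = tl es d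
      h = hd es d
      ℓ₁ : Fin m → ℤ
      ℓ₁ = bump (L t) d (- σ t)
      ring : ∀ a s b c → ((a + s * b) + (- s) * (b + c)) + (a + s * c) ≡ 2ℤ * a
      ring = solve-∀
    -- `W` is the colour on `Y` and zero elsewhere. Paired with the all-ones labelling it cancels
    -- along every edge but `e`, leaving a sign, whereas regularity makes the same sum a multiple of
    -- `r`.
    result (no proper) = contradiction (trans (sym vertexwise) edgewise) (r∤sign (sum W) (sign u u∈Y))
      where
      W : Fin n → ℤ
      W x = χ (Y x) * σ x
      vertexwise : sum (λ x → W x * ∂ 1ℤ es (const 1ℤ) x) ≡ sum W * ℤ.+ r
      vertexwise = trans (sum-cong-≗ λ x → cong (W x *_) (regular x)) (sym (*-distribʳ-sum (ℤ.+ r) W))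
      Yw : Y w ≡ false
      Yw with Y w in eq
      ... | false = refl
      ... | true  = ⊥-elim (true≢false (Y⊆X w eq) Xw)
      Wu : W u ≡ σ u
      Wu = trans (cong (λ b → χ b * σ u) u∈Y) (ℤ.*-identityˡ _)
      Ww : W w ≡ 0ℤ
      Ww = cong (λ b → χ b * σ w) Yw
      balanced : ∀ d → d ≢ e → 1ℤ * (W (hd es d) + 1ℤ * W (tl es d)) ≡ 0ℤ
      balanced d d≢e with Y (tl es d) in Yt | Y (hd es d) in Yh
      ... | false | false = refl
      ... | true  | false = ⊥-elim (true≢false (trans (sym (closed d d≢e)) Yt) Yh)
      ... | false | true  = ⊥-elim (true≢false (trans (closed d d≢e) Yh) Yt)
      ... | true  | true  = trans (ring (σ (hd es d)) (σ (tl es d))) (signs-cancel (sign _ Yt) (sign _ Yh)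
              λ same → proper (d , d≢e , Yt , Yh , same))
        where
        ring : ∀ a b → 1ℤ * (1ℤ * a + 1ℤ * (1ℤ * b)) ≡ b + a
        ring = solve-∀
      at-e : 1ℤ * (W (hd es e) + 1ℤ * W (tl es e)) ≡ σ u
      at-e = case link of λ where
          (inj₁ eq) → trans (cong (λ p → 1ℤ * (W (proj₂ p) + 1ℤ * W (proj₁ p))) eq)
                        (trans (cong₂ (λ a b → 1ℤ * (a + 1ℤ * b)) Ww Wu) (ring₁ (σ u)))
          (inj₂ eq) → trans (cong (λ p → 1ℤ * (W (proj₂ p) + 1ℤ * W (proj₁ p))) eq)
                        (trans (cong₂ (λ a b → 1ℤ * (a + 1ℤ * b)) Wu Ww) (ring₂ (σ u)))
        where
        ring₁ : ∀ a → 1ℤ * (0ℤ + 1ℤ * a) ≡ a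
        ring₁ = solve-∀
        ring₂ : ∀ a → 1ℤ * (a + 1ℤ * 0ℤ) ≡ a
        ring₂ = solve-∀
      edgewise : sum (λ x → W x * ∂ 1ℤ es (const 1ℤ) x) ≡ σ u
      edgewise = trans (pairing 1ℤ es W (const 1ℤ)) (trans (sum-single _ e balanced) at-e)

  cutEdge-label : ∀ X → CutEdge es X e → ∃ λ ℓ → (∀ x → ∂ 1ℤ es ℓ x ≡ 0ℤ) × ℓ e ≡ 2ℤ
  cutEdge-label X (cross , unique) = by-side (X (tl es e)) (X (hd es e)) refl refl
    where
    closed : ∀ d → d ≢ e → X (tl es d) ≡ X (hd es d)
    closed d d≢e = xor-≡ (X (tl es d)) (X (hd es d)) (λ p → d≢e (unique d p))
      where
      xor-≡ : ∀ a b → a xor b ≢ true → a ≡ b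
      xor-≡ false false _ = refl
      xor-≡ true  true  _ = refl
      xor-≡ false true  p = contradiction refl p
      xor-≡ true  false p = contradiction refl p
    combine : ∀ {u w} → X u ≡ true → X w ≡ false → Link es e u w → ∃ λ ℓ → (∀ x → ∂ 1ℤ es ℓ x ≡ 0ℤ) × ℓ e ≡ 2ℤ
    combine {u} {w} Xu Xw link =
      let ℓ₁ , ∂₁ , off₁ = dead-end X Xw link (colour X u Xu closed)
          ℓ₂ , ∂₂ , off₂ = dead-end (not ∘ X) {w} {u} (cong not Xu) (link-sym es link)
                             (colour (not ∘ X) w (cong not Xw) (λ d d≢e → cong not (closed d d≢e)))
          ℓ₃ = λ d → ℓ₁ d + ℓ₂ d
          ℓ₄ = λ d → -1ℤ * ℓ₃ d
      -- Both closed walks are negated, so the 2 placed on `e` cancels the -2 at each of its ends.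
      in bump ℓ₄ e 2ℤ
        , (λ x → trans (∂⁺-bump-link es ℓ₄ link 2ℤ x) (trans (cong (_+ 2ℤ * (δ x u + δ x w))
            (trans (∂-* 1ℤ es -1ℤ ℓ₃ x) (cong (-1ℤ *_) (trans (∂-+ 1ℤ es ℓ₁ ℓ₂ x) (cong₂ _+_ (∂₁ x) (∂₂ x))))))
            (ring (δ x u) (δ x w))))
        , trans (bump-eq ℓ₄ e 2ℤ) (cong (λ z → -1ℤ * z + 2ℤ) (cong₂ _+_ off₁ off₂))
      where
      ring : ∀ a b → -1ℤ * (2ℤ * a + 2ℤ * b) + 2ℤ * (a + b) ≡ 0ℤ
      ring = solve-∀
    by-side : ∀ p q → X (tl es e) ≡ p → X (hd es e) ≡ q → ∃ λ ℓ → (∀ x → ∂ 1ℤ es ℓ x ≡ 0ℤ) × ℓ e ≡ 2ℤ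
    by-side true  false Xt Xh = combine Xt Xh (inj₁ refl)
    by-side false true  Xt Xh = combine Xh Xt (inj₂ refl)
    by-side true  true  Xt Xh = ⊥-elim (true≢false cross (cong₂ _xor_ Xt Xh))
    by-side false false Xt Xh = ⊥-elim (true≢false cross (cong₂ _xor_ Xt Xh))

-- Cut edges are bridges

-- A system with exactly one member in each class. Component counts are lengths of deduplicated
-- lists for two different relations; they become comparable because all such systems for one
-- relation have the same length.
record Representatives {A : Set} (R : Rel A 0ℓ) (xs : List A) : Set where
  constructor reps
  field
    apart : AllPairs (λ x y → ¬ R x y) xs
    all   : ∀ z → Any (R z) xs

open Representatives

lookup-apart : {A : Set} {R : Rel A 0ℓ} → (∀ {x y} → R x y → R y x) → {xs : List A} →
  AllPairs (λ x y → ¬ R x y) xs → ∀ {i j} → R (lookup xs i) (lookup xs j) → i ≡ j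
lookup-apart R-sym (_ ∷ _)  {zero}  {zero}  r = refl
lookup-apart R-sym (¬r ∷ _) {zero}  {suc j} r = contradiction r (All.lookup ¬r (∈-lookup j))
lookup-apart R-sym (¬r ∷ _) {suc i} {zero}  r = contradiction (R-sym r) (All.lookup ¬r (∈-lookup i))
lookup-apart R-sym (_ ∷ ap) {suc i} {suc j} r = cong suc (lookup-apart R-sym ap r)

representatives-≤ : {A : Set} {R : Rel A 0ℓ} → IsEquivalence R → {xs ys : List A} →
  Representatives R xs → Representatives R ys → length xs ≤ length ys
representatives-≤ {R = R} equiv {xs} {ys} X Y = Fin.injective⇒≤ {f = f} λ {i} {j} eq →
    lookup-apart R.sym (apart X) (R.trans (related i) (R.sym (subst (λ k → R (lookup xs j) (lookup ys k)) (sym eq) (related j))))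
  where
  module R = IsEquivalence equiv
  f : Fin (length xs) → Fin (length ys)
  f i = index (all Y (lookup xs i))
  related : ∀ i → R (lookup xs i) (lookup ys (f i))
  related i = Any.lookup-index (all Y (lookup xs i))

representatives-length : {A : Set} {R : Rel A 0ℓ} → IsEquivalence R → {xs ys : List A} →
  Representatives R xs → Representatives R ys → length xs ≡ length ys
representatives-length equiv X Y = ℕ.≤-antisym (representatives-≤ equiv X Y) (representatives-≤ equiv Y X)

deduplicate-representatives : {R : Rel (Fin n) 0ℓ} → IsEquivalence R → (R? : Decidable R) →
  Representatives R (deduplicate R? (allFin n))
deduplicate-representatives {n} equiv R? = reps
    (Unique.deduplicate-! (record { isDecEquivalence = record { isEquivalence = equiv ; _≟_ = R? } }) (allFin n))
    (λ z → Any.deduplicate⁺ R? (λ y≈x Rzx → R.trans Rzx (R.sym y≈x)) (lose (∈-allFin z) R.refl))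
  where module R = IsEquivalence equiv

-- Dropping the representative of the class of v leaves representatives for R′.
module _ {R : Rel (Fin n) 0ℓ} (equiv : IsEquivalence R) (R? : Decidable R)
  {R′ : Rel (Fin n) 0ℓ} (equiv′ : IsEquivalence R′) (R′? : Decidable R′) {u v : Fin n}
  (R⇒R′ : ∀ {x y} → R x y → R′ x y) (R′uv : R′ u v) (¬Ruv : ¬ R u v)
  (merge : ∀ {x y} → R′ x y → R x y ⊎ ((R u x ⊎ R v x) × (R u y ⊎ R v y))) where
  private
    module R  = IsEquivalence equiv
    module R′ = IsEquivalence equiv′

    old : List (Fin n)
    old = deduplicate R? (allFin n)

    old-representatives : Representatives R old
    old-representatives = deduplicate-representatives equiv R?

    rest : List (Fin n)
    rest = filter (¬? ∘ R? v) old

    rest-v : All (λ x → ¬ R v x) rest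
    rest-v = All.all-filter (¬? ∘ R? v) old

    rest-apart : AllPairs (λ x y → ¬ R x y) rest
    rest-apart = AllPairs.filter⁺ (¬? ∘ R? v) (apart old-representatives)

    keep : ∀ {P : Fin n → Set} → Any (λ x → P x × ¬ R v x) old → Any P rest
    keep p = case Any.filter⁺ (¬? ∘ R? v) p of λ where
      (inj₁ q)  → Any.map proj₁ q
      (inj₂ ¬q) → contradiction (proj₂ (Any.lookup-result p)) ¬q

    v∷rest : Representatives R (v ∷ rest)
    v∷rest = reps (rest-v ∷ rest-apart) λ z → case R? z v of λ where
      (yes Rzv) → here Rzv
      (no ¬Rzv) → there (keep (Any.map (λ Rzx → Rzx , λ Rvx → ¬Rzv (R.trans Rzx (R.sym Rvx)))
                    (all old-representatives z)))

    apart′ : ∀ {xs} → All (λ x → ¬ R v x) xs → AllPairs (λ x y → ¬ R x y) xs → AllPairs (λ x y → ¬ R′ x y) xs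
    apart′ []         []         = []
    apart′ (¬v ∷ ¬vs) (¬r ∷ ¬rs) = All.zipWith (λ (¬vy , ¬xy) r′ → case merge r′ of λ where
        (inj₁ r)                         → ¬xy r
        (inj₂ (inj₂ vx , _))             → ¬v vx
        (inj₂ (inj₁ _ , inj₂ vy))        → ¬vy vy
        (inj₂ (inj₁ ux , inj₁ uy))       → ¬xy (R.trans (R.sym ux) uy)) (¬vs , ¬r)
      ∷ apart′ ¬vs ¬rs

    rest-representatives : Representatives R′ rest
    rest-representatives = reps (apart′ rest-v rest-apart) λ z → case R? v z of λ where
      (yes Rvz) → keep (Any.map (λ Rux → R′.trans (R⇒R′ (R.sym Rvz)) (R′.trans (R′.sym R′uv) (R⇒R′ Rux))
                                        , λ Rvx → ¬Ruv (R.trans Rux (R.sym Rvx)))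
                    (all old-representatives u))
      (no ¬Rvz) → keep (Any.map (λ Rzx → R⇒R′ Rzx , λ Rvx → ¬Rvz (R.trans Rvx (R.sym Rzx)))
                    (all old-representatives z))

  deduplicate-merge : length (deduplicate R? (allFin n)) ≡ suc (length (deduplicate R′? (allFin n)))
  deduplicate-merge = trans (representatives-length equiv old-representatives v∷rest)
    (cong suc (representatives-length equiv′ rest-representatives (deduplicate-representatives equiv′ R′?)))

module _ (G : Graph n (suc m)) (e : Fin (suc m)) (X : Fin n → Bool) (cut : CutEdge (ends G) X e) where
  private
    u v : Fin n
    u = tl (ends G) e
    v = hd (ends G) e

    Con Con′ : Rel (Fin n) 0ℓ
    Con  = Connected (removeAt (ends G) e)
    Con′ = Connected (ends G)

    equiv : IsEquivalence Con
    equiv = EqC.isEquivalence _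

    equiv′ : IsEquivalence Con′
    equiv′ = EqC.isEquivalence _

    Con⇒Con′ : ∀ {x y} → Con x y → Con′ x y
    Con⇒Con′ = EqC.map λ { (f , eq) → punchIn e f , eq }

    same-side : ∀ {x y} → Con x y → X x ≡ X y
    same-side = EqC.fold (On.isEquivalence X isEquivalence) λ { (f , refl) → not-crossing f }
      where
      xor-false : ∀ {a b} → ¬ (a xor b ≡ true) → a ≡ b
      xor-false {false} {false} _ = refl
      xor-false {true}  {true}  _ = refl
      xor-false {false} {true}  p = contradiction refl p
      xor-false {true}  {false} p = contradiction refl p
      not-crossing : ∀ f → X (tl (ends G) (punchIn e f)) ≡ X (hd (ends G) (punchIn e f))
      not-crossing f = xor-false λ p → Fin.punchInᵢ≢i e f (proj₂ cut (punchIn e f) p)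

    xor-self : ∀ b → ¬ (b xor b ≡ true)
    xor-self false ()
    xor-self true  ()

    ¬Con-uv : ¬ Con u v
    ¬Con-uv c = xor-self (X u) (subst (λ b → X u xor b ≡ true) (sym (same-side c)) (proj₁ cut))

    open IsEquivalence equiv renaming (refl to c-refl; sym to c-sym; trans to c-trans)

    Near : Fin n → Set
    Near x = Con u x ⊎ Con v x

    near : ∀ {x y} → Con x y → Near x → Near y
    near c (inj₁ p) = inj₁ (c-trans p c)
    near c (inj₂ p) = inj₂ (c-trans p c)

    -- `Con` with the classes of `u` and `v` fused. As `Con′` is the least equivalence containing
    -- the edges, it lies in this one as soon as every edge does.
    Merged : Rel (Fin n) 0ℓ
    Merged x y = Con x y ⊎ (Near x × Near y)

    merged-equiv : IsEquivalence Merged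
    merged-equiv = record
      { refl  = inj₁ c-refl
      ; sym   = λ { (inj₁ c) → inj₁ (c-sym c) ; (inj₂ (p , q)) → inj₂ (q , p) }
      ; trans = λ { (inj₁ c) (inj₁ d) → inj₁ (c-trans c d)
                  ; (inj₁ c) (inj₂ (p , q)) → inj₂ (near (c-sym c) p , q)
                  ; (inj₂ (p , q)) (inj₁ d) → inj₂ (p , near d q)
                  ; (inj₂ (p , _)) (inj₂ (_ , q)) → inj₂ (p , q) } }

    merge : ∀ {x y} → Con′ x y → Merged x y
    merge = EqC.fold merged-equiv λ { (f , refl) → step f (f Fin.≟ e) }
      where
      step : ∀ f → Dec (f ≡ e) → Merged (tl (ends G) f) (hd (ends G) f)
      step f (yes refl) = inj₂ (inj₁ c-refl , inj₂ c-refl)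
      step f (no f≢e)   = inj₁ (EqC.return (punchOut (f≢e ∘ sym) , cong (ends G) (Fin.punchIn-punchOut (f≢e ∘ sym))))

  cutEdge-isBridge : IsBridge G e
  cutEdge-isBridge = deduplicate-merge equiv (connected? (removeAt (ends G) e)) equiv′ (connected? (ends G)) {u} {v}
    Con⇒Con′ (EqC.return (e , refl)) ¬Con-uv merge

-- Labellings with several coordinates

listSum : List ℤ → ℤ
listSum = foldr _+_ 0ℤ

listSum-filter : ∀ {k} {P : Fin m → Set} (P? : Unary.Decidable P) (ℓ : Fin m → ℤ) (g : Fin k → Fin m) →
  listSum (map ℓ (filter P? (tabulate g))) ≡ sum λ i → χ (does (P? (g i))) * ℓ (g i)
listSum-filter {k = zero}  P? ℓ g = refl
listSum-filter {k = suc k} P? ℓ g with does (P? (g zero))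
... | true  = cong₂ _+_ (sym (ℤ.*-identityˡ (ℓ (g zero)))) (listSum-filter P? ℓ (g ∘ suc))
... | false = trans (listSum-filter P? ℓ (g ∘ suc)) (sym (ℤ.+-identityˡ _))

module _ (G : Graph n m) where

  -- This is where looplessness enters: `incidentEdges` would list a loop once, while the unsigned
  -- boundary would count it twice.
  ∂-incidentEdges : ∀ ℓ v → listSum (map ℓ (incidentEdges G v)) ≡ ∂ 1ℤ (ends G) ℓ v
  ∂-incidentEdges ℓ v = trans (listSum-filter (incident? G v) ℓ id) (sum-cong-≗ term)
    where
    ring₁ : ∀ z → 1ℤ * z ≡ z * (0ℤ + 1ℤ * 1ℤ)
    ring₁ = solve-∀
    ring₂ : ∀ z → 1ℤ * z ≡ z * (1ℤ + 1ℤ * 0ℤ)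
    ring₂ = solve-∀
    term : ∀ e → χ (does (incident? G v e)) * ℓ e ≡ ℓ e * (δ v (hd (ends G) e) + 1ℤ * δ v (tl (ends G) e))
    term e with v Fin.≟ proj₁ (ends G e) | v Fin.≟ proj₂ (ends G e)
    ... | yes refl | yes v≡h = contradiction v≡h (loopless G e)
    ... | yes refl | no v≢h  = trans (ring₁ (ℓ e)) (cong₂ (λ a b → ℓ e * (a + 1ℤ * b)) (sym (δ-≢ v≢h)) (sym (δ-refl v)))
    ... | no v≢t   | yes refl = trans (ring₂ (ℓ e)) (cong₂ (λ a b → ℓ e * (a + 1ℤ * b)) (sym (δ-refl v)) (sym (δ-≢ v≢t)))
    ... | no v≢t   | no v≢h  = trans (sym (ℤ.*-zeroʳ (ℓ e))) (cong₂ (λ a b → ℓ e * (a + 1ℤ * b)) (sym (δ-≢ v≢h)) (sym (δ-≢ v≢t)))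

  ∂-degree : ∀ v → ∂ 1ℤ (ends G) (const 1ℤ) v ≡ ℤ.+ degree G v
  ∂-degree v = trans (sym (∂-incidentEdges (const 1ℤ) v)) (ones (incidentEdges G v))
    where
    ones : ∀ (xs : List (Fin m)) → listSum (map (const 1ℤ) xs) ≡ ℤ.+ length xs
    ones []       = refl
    ones (x ∷ xs) = cong (1ℤ +_) (ones xs)

-- Reversing the sign at the tail changes the boundary by an even amount, so labellings found as
-- signed flows serve the unsigned zero-sum condition.
∂-even : (es : Ends n m) (f : Fin m → ℤ) → ∀ x → 2ℤ ∣ ∂ -1ℤ es f x → 2ℤ ∣ ∂ 1ℤ es f x
∂-even es f x even = subst (2ℤ ∣_) (sym total) (∣m∣n⇒∣m+n even (∣m⇒∣m*n _ (divides 1ℤ refl)))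
  where
  ring : ∀ f a b → f * (a + 1ℤ * b) ≡ f * (a + -1ℤ * b) + 2ℤ * (f * b)
  ring = solve-∀
  tails : Fin _ → ℤ
  tails e = f e * δ x (tl es e)
  total : ∂ 1ℤ es f x ≡ ∂ -1ℤ es f x + 2ℤ * sum tails
  total = trans (sum-cong-≗ λ e → ring (f e) (δ x (hd es e)) (δ x (tl es e)))
    (trans (∑-distrib-+ (λ e → f e * (δ x (hd es e) + -1ℤ * δ x (tl es e))) _)
           (cong (∂ -1ℤ es f x +_) (sym (*-distribˡ-sum 2ℤ tails))))

-- Decidability of magic and the least number of coordinates

module _ (𝔸 : AbelianGroup 0ℓ 0ℓ) where
  private module A = AbelianGroup 𝔸

  -- An upper bound alone does not produce the value of ζ constructively: finding the least number
  -- of coordinates requires deciding each smaller one.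
  zeroSumMagic? : Search A.Carrier A._≈_ → Decidable A._≈_ → (G : Graph n m) → Dec (ZeroSumMagic 𝔸 G)
  zeroSumMagic? {n} {m} search _≈?_ G = search-Vector A.refl search m _
    (λ {φ} {ψ} φ≈ψ (nonzero , zero-sum) →
        (λ e ψe≈ε → nonzero e (A.trans (φ≈ψ e) ψe≈ε))
      , (λ v → A.trans (fold-cong (λ e → A.sym (φ≈ψ e)) (incidentEdges G v)) (zero-sum v)))
    (λ φ → Fin.all? (λ e → ¬? (φ e ≈? A.ε)) ×-dec
           Fin.all? (λ v → foldr A._∙_ A.ε (map φ (incidentEdges G v)) ≈? A.ε))
    where
    fold-cong : {φ ψ : Fin m → A.Carrier} → (∀ e → φ e A.≈ ψ e) → ∀ xs →
      foldr A._∙_ A.ε (map φ xs) A.≈ foldr A._∙_ A.ε (map ψ xs)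
    fold-cong φ≈ψ []       = A.refl
    fold-cong φ≈ψ (x ∷ xs) = A.∙-cong (φ≈ψ x) (fold-cong φ≈ψ xs)

search-ℤMod : ∀ k .{{_ : ℕ.NonZero k}} → Search ℤ (AbelianGroup._≈_ (ℤMod k))
search-ℤMod k P resp P? = map′ (λ (i , p) → _ , p) residue (Fin.any? λ i → P? (ℤ.+ toℕ i))
  where
  residue : ∃ P → ∃ λ (i : Fin k) → P (ℤ.+ toℕ i)
  residue (x , p) = fromℕ< (ℤ.n%ℕd<d x k) , resp (divides (x ℤ./ℕ k) (begin
      x - ℤ.+ toℕ (fromℕ< (ℤ.n%ℕd<d x k))
        ≡⟨ cong (λ r → x - ℤ.+ r) (Fin.toℕ-fromℕ< (ℤ.n%ℕd<d x k)) ⟩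
      x - ℤ.+ (x ℤ.%ℕ k)
        ≡⟨ cong (_- ℤ.+ (x ℤ.%ℕ k)) (ℤ.a≡a%ℕn+[a/ℕn]*n x k) ⟩
      ℤ.+ (x ℤ.%ℕ k) + (x ℤ./ℕ k) * ℤ.+ k - ℤ.+ (x ℤ.%ℕ k)
        ≡⟨ ring (ℤ.+ (x ℤ.%ℕ k)) ((x ℤ./ℕ k) * ℤ.+ k) ⟩
      (x ℤ./ℕ k) * ℤ.+ k ∎)) p
    where
    open ≡-Reasoning
    ring : ∀ a b → a + b - a ≡ b
    ring = solve-∀

ℤMod^-magic? : ∀ k .{{_ : ℕ.NonZero k}} c (G : Graph n m) → Dec (ZeroSumMagic (ℤMod^ k c) G)
ℤMod^-magic? k c = zeroSumMagic? (ℤMod^ k c)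
  (search-Vector (λ {x} → AbelianGroup.refl (ℤMod k) {x}) (search-ℤMod k) c)
  (λ f g → Fin.all? λ i → ℤ.+ k ∣? f i - g i)

least : {P : ℕ → Set} → (∀ c → Dec (P c)) → ∀ c → P c → ∃ λ d → d ≤ c × P d × (∀ d′ → P d′ → d ≤ d′)
least {P} P? c p = go (suc c) c ℕ.≤-refl p
  where
  go : ∀ k c → c < k → P c → ∃ λ d → d ≤ c × P d × (∀ d′ → P d′ → d ≤ d′)
  go (suc k) c (s≤s c≤k) p = case ℕ.anyUpTo? P? c of λ where
    (no none) → c , ℕ.≤-refl , p , λ d′ p′ → ℕ.≮⇒≥ λ d′<c → none (d′ , d′<c , p′)
    (yes (d , d<c , p′)) → let d₀ , d₀≤d , rest = go k d (ℕ.≤-trans d<c c≤k) p′ in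
      d₀ , ℕ.≤-trans d₀≤d (ℕ.<⇒≤ d<c) , rest

isZeta-≤ : ∀ k .{{_ : ℕ.NonZero k}} (G : Graph n m) {c} → 1 ≤ c → ZeroSumMagic (ℤMod^ k c) G →
  ∃ λ (ζ : ℕ ⁺) → IsZeta k G ζ × ζ ≤⁺ [ c ]
isZeta-≤ k G {c} 1≤c magic =
  let d , d≤c , (1≤d , magic-d) , minimal = least (λ c → (1 ℕ.≤? c) ×-dec ℤMod^-magic? k c G) c (1≤c , magic)
  in [ d ] , (1≤d , magic-d , λ d′ 1≤d′ magic′ → minimal d′ (1≤d′ , magic′)) , [ d≤c ]

-- The labelling of a regular graph

cutEdge⇒bridge : (G : Graph n m) (X : Fin n → Bool) (e : Fin m) → CutEdge (ends G) X e → e ∈ bridges G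
cutEdge⇒bridge {m = suc m} G X e cut = ∈-filter⁺ (isBridge? G) (∈-allFin e) (cutEdge-isBridge G e X cut)

fold-at : ∀ k c (φ : Fin m → Fin c → ℤ) i xs → let module A = AbelianGroup (ℤMod^ k c) in
  foldr A._∙_ A.ε (map φ xs) i ≡ listSum (map (λ e → φ e i) xs)
fold-at k c φ i []       = refl
fold-at k c φ i (x ∷ xs) = cong (φ x i +_) (fold-at k c φ i xs)

module _ (j r : ℕ) (2≤j : 2 ≤ j) (2≤r : 2 ≤ r) (G : Graph n m) (regular : Regular r G) where
  private
    instance
      j≢0 : ℕ.NonZero j
      j≢0 = ℕ.>-nonZero (ℕ.≤-trans (s≤s z≤n) 2≤j)

    open Cover (coverOf (ends G))

    cut-label : ∀ e → ∃ λ ℓ → (∀ x → ∂ 1ℤ (ends G) ℓ x ≡ 0ℤ) × ((∃ λ i → Odd (F i e)) ⊎ ℓ e ≡ 2ℤ)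
    cut-label e = case cover e (loopless G e) of λ where
      -- The zero labelling is a harmless default: if the cover gives an odd label to an entry of
      -- `bridges G`, that entry is already nonzero in one of the three shared coordinates.
      (inj₁ odd) → const 0ℤ , ∂-0 1ℤ (ends G) , inj₁ odd
      (inj₂ (X , cut)) → let ℓ , ∂ℓ , ℓe = cutEdge-label (ends G) r 2≤r
                                (λ x → trans (∂-degree G x) (cong ℤ.+_ (regular x))) e X cut
                         in ℓ , ∂ℓ , inj₂ ℓe

    B : ℕ
    B = length (bridges G)

    coordinate : Fin 3 ⊎ Fin B → Fin m → ℤ
    coordinate (inj₁ i) e = ℤ.+ j * F i e
    coordinate (inj₂ b) e = proj₁ (cut-label (lookup (bridges G) b)) e

    φ : Fin m → Fin (3 ℕ.+ B) → ℤ
    φ e i = coordinate (splitAt 3 i) e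

    2j : ℤ.+ (2 ℕ.* j) ≡ ℤ.+ j * 2ℤ
    2j = trans (cong ℤ.+_ (ℕ.*-comm 2 j)) (ℤ.pos-* j 2)

    zero-sum : ∀ c v → ℤ.+ (2 ℕ.* j) ∣ ∂ 1ℤ (ends G) (coordinate c) v
    zero-sum (inj₁ i) v = subst₂ _∣_ (sym 2j) (sym (∂-* 1ℤ (ends G) (ℤ.+ j) (F i) v))
      (*-monoʳ-∣ (ℤ.+ j) (∂-even (ends G) (F i) v (even i v)))
    zero-sum (inj₂ b) v = subst (ℤ.+ (2 ℕ.* j) ∣_) (sym (proj₁ (proj₂ (cut-label (lookup (bridges G) b))) v)) (divides 0ℤ refl)

    Vanishes : Fin m → Set
    Vanishes e = ∀ i → ℤ.+ (2 ℕ.* j) ∣ φ e i - 0ℤ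

    coordinate-∣ : ∀ {e} → Vanishes e → ∀ c i → splitAt 3 i ≡ c → ℤ.+ (2 ℕ.* j) ∣ coordinate c e
    coordinate-∣ {e} vanishes c i refl = subst (ℤ.+ (2 ℕ.* j) ∣_) (ℤ.+-identityʳ _) (vanishes i)

    odd-nonzero : ∀ e → (∃ λ i → Odd (F i e)) → ¬ Vanishes e
    -- Cancelling `j` from `2j` dividing `j * F i e` would make `F i e` even.
    odd-nonzero e (i , odd) vanishes = odd (*-cancelˡ-∣ (ℤ.+ j)
      (subst (_∣ ℤ.+ j * F i e) 2j (coordinate-∣ vanishes (inj₁ i) (i ↑ˡ B) (Fin.splitAt-↑ˡ 3 i B))))

    2j∤2 : ¬ ℤ.+ (2 ℕ.* j) ∣ 2ℤ
    2j∤2 p = ℕ.<⇒≱ (ℕ.*-monoʳ-< 2 2≤j) (ℕ.∣⇒≤ (∣⇒∣ᵤ p))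

    cut-nonzero : ∀ e → e ∈ bridges G → ¬ Vanishes e
    cut-nonzero e e∈ vanishes = case proj₂ (proj₂ (cut-label (lookup (bridges G) b))) of λ where
        (inj₁ odd) → odd-nonzero e (subst (λ e → ∃ λ i → Odd (F i e)) (sym e≡) odd) vanishes
        (inj₂ ℓ≡2) → 2j∤2 (subst (ℤ.+ (2 ℕ.* j) ∣_)
          (trans (cong (proj₁ (cut-label (lookup (bridges G) b))) e≡) ℓ≡2)
          (coordinate-∣ vanishes (inj₂ b) (3 ↑ʳ b) (Fin.splitAt-↑ʳ 3 B b)))
      where
      b : Fin B
      b = Any.index e∈
      e≡ : e ≡ lookup (bridges G) b
      e≡ = Any.lookup-index e∈

  regular-magic : ZeroSumMagic (ℤMod^ (2 ℕ.* j) (3 ℕ.+ B)) G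
  regular-magic = φ
    , (λ e vanishes → case cover e (loopless G e) of λ where
        (inj₁ odd)       → odd-nonzero e odd vanishes
        (inj₂ (X , cut)) → cut-nonzero e (cutEdge⇒bridge G X e cut) vanishes)
    , (λ v i → subst (ℤ.+ (2 ℕ.* j) ∣_)
        (sym (trans (ℤ.+-identityʳ _) (trans (fold-at (2 ℕ.* j) (3 ℕ.+ B) φ i (incidentEdges G v))
          (∂-incidentEdges G (λ e → φ e i) v))))
        (zero-sum (splitAt 3 i) v))

corollary3p2 : ∀ (j r : ℕ) → 2 ≤ j → 2 ≤ r → ∀ {n m : ℕ} (G : Graph n m) → Regular r G →
    ∃ λ (ζ : ℕ ⁺) → IsZeta (2 ℕ.* j) G ζ × ζ ≤⁺ [ 3 ℕ.+ length (bridges G) ]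
corollary3p2 j r 2≤j 2≤r G regular =
  isZeta-≤ (2 ℕ.* j) {{ℕ.>-nonZero (ℕ.≤-trans (s≤s z≤n) (ℕ.*-monoʳ-≤ 2 (ℕ.≤-trans (ℕ.n≤1+n 1) 2≤j)))}} G
    (s≤s z≤n) (regular-magic j r 2≤j 2≤r G regular)
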